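{- There is a constant $c>0$ such that the following holds for all $k,n,W\in\mathbb{N}$ with $k,n,W\ge1$ and every $k$-variate threshold function $f\in\mathbb{T}^W_{k,n}$. There is a $\pi_{k,n}$-OBDD representing $f$ whose width is at most $c\,kW$ and whose size is at most $c\,k^2Wn$, where $\pi_{k,n}$ is the $k$-interleaved variable order with decreasing significance. Moreover, such an OBDD can be constructed in time $O(k^2Wn)$.
   Context: For $x=(x_0,\dots,x_{n-1})\in\{0,1\}^n$ put $|x|=\sum_i x_i2^i$. A function $f:\{0,1\}^{kn}\to\{0,1\}$ on input vectors $x^{(1)},\dots,x^{(k)}\in\{0,1\}^n$ is a $k$-variate threshold function with weight bound $W$ if there exist $T\in\mathbb{Z}$ and weights $w_1,\dots,w_k\in\{ -W,\dots,W\}$ such that $f(x^{(1)},\dots,x^{(k)})=1$ iff $\sum_{j=1}^k w_j|x^{(j)}|\ge T$. The set of such functions is $\mathbb{T}^W_{k,n}$. The $k$-interleaved variable order with decreasing significance is $(x^{(1)}_{n-1},\dots,x^{(k)}_{n-1},x^{(1)}_{n-2},\dots,x^{(k)}_{n-2},\dots,x^{(1)}_0,\dots,x^{(k)}_0)$. A $\pi$-OBDD for a variable order $\pi$ (a linear order of the input variables) is a directed acyclic rooted graph with two sinks labeled $0$ and $1$. Every inner node is labeled by a variable and has two outgoing edges labeled $0$ and $1$, and along every edge the variables respect $\pi$. An assignment determines a path from the root by following, at each node labeled $x_i$, the edge labeled by the value of $x_i$. The OBDD represents $f$ if this path always ends in the sink labeled $f(\text{assignment})$. The size is the number of nodes,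 and the width is the maximum number of nodes labeled by the same variable. -}

module Defs where

open import Data.Bool.Base using (Bool; true; false; if_then_else_)
open import Data.Fin.Base as Fin using (Fin; toℕ)
import Data.Fin.Properties as Fin
open import Data.Integer.Base as ℤ using (ℤ; +_; 0ℤ; 1ℤ)
import Data.Integer.Properties as ℤ
open import Data.List.Base using (List; []; _∷_; _++_; [_]; map; concatMap; filter; length; allFin; tabulate; cartesianProduct)
open import Data.List.Extrema.Nat using (max)
open import Data.Nat.Base as ℕ using (ℕ)
import Data.Nat.Properties as ℕ
open import Data.Product.Base using (_×_; _,_; ∃-syntax; proj₁; proj₂)
open import Data.Product.Properties using (≡-dec)
open import Data.Product.Relation.Binary.Lex.Strict using (×-Lex; ×-isStrictTotalOrder)
open import Data.Product.Relation.Binary.Pointwise.NonDependent using (Pointwise; ≡×≡⇒≡; ≡⇒≡×≡)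
open import Data.Vec.Functional using (Vector)
open import Function.Base using (flip; _∘_)
open import Function.Bundles using (_⇔_)
open import Level using (0ℓ)
open import Relation.Binary.Core using (Rel)
open import Relation.Binary.Definitions using (DecidableEquality; Tri; tri<; tri≈; tri>)
open import Relation.Binary.PropositionalEquality using (_≡_; isEquivalence; resp₂)
open import Relation.Binary.Structures using (IsStrictTotalOrder)
import Relation.Binary.Construct.Flip.EqAndOrd as Flip
open import Relation.Nullary.Decidable.Core using (does)

open import Algebra.Properties.Monoid.Sum ℕ.+-0-monoid
  using () renaming (sum to sumℕ)
open import Algebra.Properties.Monoid.Sum ℤ.+-0-monoid
  using () renaming (sum to sumℤ)

bit : Bool → ℕ
bit b = if b then 1 else 0

∣_∣₂ : ∀ {n} → Vector Bool n → ℕ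
∣ x ∣₂ = sumℕ (λ i → bit (x i) ℕ.* 2 ℕ.^ toℕ i)

-- x j i is the bit of significance i of the (j+1)-st input vector.
Input : ℕ → ℕ → Set
Input k n = Vector (Vector Bool n) k

WeightsBoundedBy : ∀ {k} → ℕ → Vector ℤ k → Set
WeightsBoundedBy W w = ∀ j → (ℤ.- (+ W) ℤ.≤ w j) × (w j ℤ.≤ + W)

IsThresholdOf : ∀ {k n} → ℤ → Vector ℤ k → (Input k n → Bool) → Set
IsThresholdOf T w f =
  ∀ x → (f x ≡ true) ⇔ (sumℤ (λ j → w j ℤ.* (+ ∣ x j ∣₂)) ℤ.≥ T)

𝕋 : (W k n : ℕ) → (Input k n → Bool) → Set
𝕋 W k n f = ∃[ T ] ∃[ w ] WeightsBoundedBy W w × IsThresholdOf T w f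

-- The pair (i , j) stands for the bit of significance i of the
-- (j+1)-st input vector.
Variable : ℕ → ℕ → Set
Variable k n = Fin n × Fin k

_≟ᵛ_ : ∀ {k n} → DecidableEquality (Variable k n)
_≟ᵛ_ = ≡-dec Fin._≟_ Fin._≟_

variables : ∀ k n → List (Variable k n)
variables k n = cartesianProduct (allFin n) (allFin k)

valueAt : ∀ {k n} → Input k n → Variable k n → Bool
valueAt x (i , j) = x j i

record VariableOrder (k n : ℕ) : Set₁ where
  field
    _≺_                : Rel (Variable k n) 0ℓ
    isStrictTotalOrder : IsStrictTotalOrder _≡_ _≺_

-- (i , j) precedes (i′ , j′) iff i > i′, or i = i′ and j < j′.
interleavedOrder : ∀ k n → VariableOrder k n
interleavedOrder k n = record
  { _≺_                = ×-Lex _≡_ (flip Fin._<_) Fin._<_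
  ; isStrictTotalOrder = record
    { isStrictPartialOrder = record
      { isEquivalence = isEquivalence
      ; irrefl        = Lex.irrefl ∘ ≡⇒≡×≡
      ; trans         = λ {x} {y} {z} → Lex.trans {x} {y} {z}
      ; <-resp-≈      = resp₂ _
      }
    ; compare = λ x y → cmp x y (Lex.compare x y)
    }
  }
  where
  lex = ×-isStrictTotalOrder
          (Flip.isStrictTotalOrder (Fin.<-isStrictTotalOrder {n}))
          (Fin.<-isStrictTotalOrder {k})
  module Lex = IsStrictTotalOrder lex
  _<ˡ_ : Rel (Variable k n) 0ℓ
  _<ˡ_ = ×-Lex _≡_ (flip Fin._<_) Fin._<_
  cmp : ∀ x y → Tri (x <ˡ y) (Pointwise _≡_ _≡_ x y) (y <ˡ x) →
        Tri (x <ˡ y) (x ≡ y) (y <ˡ x)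
  cmp _ _ (tri< a b c) = tri< a (b ∘ ≡⇒≡×≡) c
  cmp _ _ (tri≈ a b c) = tri≈ a (≡×≡⇒≡ b) c
  cmp _ _ (tri> a b c) = tri> a (b ∘ ≡⇒≡×≡) c

data Node (m : ℕ) : Set where
  sink  : Bool → Node m
  inner : Fin m → Node m

-- Acyclicity is not a separate field: `ordered` makes the labels
-- strictly increase along every edge between inner nodes, and a sink has
-- no outgoing edges.  The root is a distinguished node; nodes
-- unreachable from it are allowed (for a constant function one of the
-- two sinks always is), and they count towards width and size.
record OBDD {k n : ℕ} (π : VariableOrder k n) : Set where
  open VariableOrder π
  field
    #inner  : ℕ
    label   : Fin #inner → Variable k n
    succ    : Fin #inner → Bool → Node #inner
    root    : Node #inner
    ordered : ∀ u b v → succ u b ≡ inner v → label u ≺ label v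

module _ {k n : ℕ} {π : VariableOrder k n} (D : OBDD π) where
  open OBDD D

  -- u ⟨ x ⟩⇝ b : the path from u determined by x ends in the b-sink.
  data _⟨_⟩⇝_ : Node #inner → Input k n → Bool → Set where
    stop : ∀ {x b} → sink b ⟨ x ⟩⇝ b
    step : ∀ {x v b} →
           succ v (valueAt x (label v)) ⟨ x ⟩⇝ b → inner v ⟨ x ⟩⇝ b

  Represents : (Input k n → Bool) → Set
  Represents f = ∀ x → root ⟨ x ⟩⇝ f x

  size : ℕ
  size = #inner ℕ.+ 2

  nodesLabelled : Variable k n → ℕ
  nodesLabelled z = length (filter (λ v → label v ≟ᵛ z) (allFin #inner))

  width : ℕ
  width = max 0 (map nodesLabelled (variables k n))

-- A random access machine under the uniform cost criterion: registers
-- hold integers, addition and subtraction are the only arithmetic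
-- operations, and every operation takes one unit of time.  This is the
-- RAM of Cook and Reckhow, with its jumps replaced by structured
-- control flow and its directly addressed registers (reg) kept apart
-- from the indirectly addressed ones (mem).  Input is read from and
-- output is written to sequential tapes.  Uniform cost matters here: the
-- bound k²Wn does not involve the length of the threshold T.

data Expr : Set where
  lit       : ℤ → Expr
  reg       : ℕ → Expr
  mem       : Expr → Expr
  _⊞_ _⊟_ : Expr → Expr → Expr

data Program : Set where
  skip            : Program
  reg_≔_          : ℕ → Expr → Program
  mem_≔_          : Expr → Expr → Program
  read            : ℕ → Program
  write           : Expr → Program
  _⨟_             : Program → Program → Program
  if_>0then_else_ : Expr → Program → Program → Program
  while_>0do_     : Expr → Program → Program

infixl 6 _⊞_ _⊟_
infix  5 reg_≔_ mem_≔_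
infixr 4 _⨟_

record State : Set where
  constructor state
  field
    regs   : ℕ → ℤ
    memory : ℤ → ℤ
    input  : List ℤ
    output : List ℤ

open State

initial : List ℤ → State
initial is = state (λ _ → 0ℤ) (λ _ → 0ℤ) is []

update : ∀ {A : Set} → DecidableEquality A → (A → ℤ) → A → ℤ → (A → ℤ)
update _≟_ g a z b = if does (b ≟ a) then z else g b

⟦_⟧ : Expr → State → ℤ
⟦ lit z   ⟧ σ = z
⟦ reg a   ⟧ σ = regs σ a
⟦ mem e   ⟧ σ = memory σ (⟦ e ⟧ σ)
⟦ e ⊞ e′ ⟧ σ = ⟦ e ⟧ σ ℤ.+ ⟦ e′ ⟧ σ
⟦ e ⊟ e′ ⟧ σ = ⟦ e ⟧ σ ℤ.- ⟦ e′ ⟧ σ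

cost : Expr → ℕ
cost (lit z)   = 1
cost (reg a)   = 1
cost (mem e)   = 1 ℕ.+ cost e
cost (e ⊞ e′) = 1 ℕ.+ cost e ℕ.+ cost e′
cost (e ⊟ e′) = 1 ℕ.+ cost e ℕ.+ cost e′

setReg : ℕ → ℤ → State → State
setReg a z σ = record σ { regs = update ℕ._≟_ (regs σ) a z }

setMem : ℤ → ℤ → State → State
setMem a z σ = record σ { memory = update ℤ._≟_ (memory σ) a z }

emit : ℤ → State → State
emit z σ = record σ { output = output σ ++ [ z ] }

-- ⟨ P , σ ⟩⇓⟨ τ , t ⟩ : started in σ, P halts in τ after t units of time.
-- Reading from an exhausted input tape has no rule.
data ⟨_,_⟩⇓⟨_,_⟩ : Program → State → State → ℕ → Set where
  ⇓skip  : ∀ {σ} → ⟨ skip , σ ⟩⇓⟨ σ , 1 ⟩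
  ⇓reg   : ∀ {σ a e} →
           ⟨ reg a ≔ e , σ ⟩⇓⟨ setReg a (⟦ e ⟧ σ) σ , 1 ℕ.+ cost e ⟩
  ⇓mem   : ∀ {σ e e′} →
           ⟨ mem e ≔ e′ , σ ⟩⇓⟨ setMem (⟦ e ⟧ σ) (⟦ e′ ⟧ σ) σ
                              , 1 ℕ.+ cost e ℕ.+ cost e′ ⟩
  ⇓read  : ∀ {σ a z is} → input σ ≡ z ∷ is →
           ⟨ read a , σ ⟩⇓⟨ setReg a z (record σ { input = is }) , 1 ⟩
  ⇓write : ∀ {σ e} →
           ⟨ write e , σ ⟩⇓⟨ emit (⟦ e ⟧ σ) σ , 1 ℕ.+ cost e ⟩
  ⇓seq   : ∀ {P Q σ τ υ s t} →
           ⟨ P , σ ⟩⇓⟨ τ , s ⟩ → ⟨ Q , τ ⟩⇓⟨ υ , t ⟩ →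
           ⟨ P ⨟ Q , σ ⟩⇓⟨ υ , s ℕ.+ t ⟩
  ⇓then  : ∀ {e P Q σ τ t} → ⟦ e ⟧ σ ℤ.> 0ℤ →
           ⟨ P , σ ⟩⇓⟨ τ , t ⟩ →
           ⟨ if e >0then P else Q , σ ⟩⇓⟨ τ , 1 ℕ.+ cost e ℕ.+ t ⟩
  ⇓else  : ∀ {e P Q σ τ t} → ⟦ e ⟧ σ ℤ.≤ 0ℤ →
           ⟨ Q , σ ⟩⇓⟨ τ , t ⟩ →
           ⟨ if e >0then P else Q , σ ⟩⇓⟨ τ , 1 ℕ.+ cost e ℕ.+ t ⟩
  ⇓done  : ∀ {e P σ} → ⟦ e ⟧ σ ℤ.≤ 0ℤ →
           ⟨ while e >0do P , σ ⟩⇓⟨ σ , 1 ℕ.+ cost e ⟩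
  ⇓loop  : ∀ {e P σ τ υ s t} → ⟦ e ⟧ σ ℤ.> 0ℤ →
           ⟨ P , σ ⟩⇓⟨ τ , s ⟩ → ⟨ while e >0do P , τ ⟩⇓⟨ υ , t ⟩ →
           ⟨ while e >0do P , σ ⟩⇓⟨ υ , 1 ℕ.+ cost e ℕ.+ s ℕ.+ t ⟩

_on_Outputs_InTime_ : Program → List ℤ → List ℤ → ℕ → Set
P on is Outputs os InTime t = ∃[ τ ] ⟨ P , initial is ⟩⇓⟨ τ , t ⟩ × output τ ≡ os

encodeInstance : (k n W : ℕ) → ℤ → Vector ℤ k → List ℤ
encodeInstance k n W T w = (+ k) ∷ (+ n) ∷ (+ W) ∷ T ∷ tabulate w

encodeNode : ∀ {m} → Node m → ℤ
encodeNode (sink false) = 0ℤ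
encodeNode (sink true)  = 1ℤ
encodeNode (inner v)    = + (2 ℕ.+ toℕ v)

-- The root, followed by one record per inner node: its label and its
-- 0- and 1-successor.
encodeOBDD : ∀ {k n} {π : VariableOrder k n} → OBDD π → List ℤ
encodeOBDD D = encodeNode root ∷ concatMap entry (allFin #inner)
  where
  open OBDD D
  entry : Fin #inner → List ℤ
  entry v = (+ toℕ (proj₁ (label v))) ∷ (+ toℕ (proj₂ (label v)))
          ∷ encodeNode (succ v false) ∷ encodeNode (succ v true) ∷ []

-- Write T = (p - B) K - R with K = 2^(n-1) and B = 2kW.  Reading the bit
-- x of significance i of the j-th vector replaces p by p - x w_j, and
-- passing to the next lower significance doubles p - B and R and carries
-- modulo K, so that at the end the function has value 1 iff p ≤ B.  Since
-- the remaining weights are small, the outcome is decided as soon as p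
-- leaves the window 1 … 2B; so 2B = 4kW nodes per variable suffice.  The
-- successors of all nodes are found by additions, subtractions and
-- comparisons; the initial p and R are found by O(kW) additions of K.
module Submission where

open import Data.Bool.Base using (Bool; true; false; if_then_else_; T)
open import Data.Empty using (⊥-elim)
open import Data.Fin.Base as Fin using (Fin; zero; suc; toℕ; fromℕ<; fromℕ; inject₁; inject≤; splitAt; _↑ˡ_; _↑ʳ_)
import Data.Fin.Properties as Fin
open import Data.Integer.Base as ℤ using (ℤ; +_; -[1+_]; 0ℤ; 1ℤ)
import Data.Integer.Properties as ℤ
open import Data.Integer.Tactic.RingSolver using (solve-∀)
open import Data.List.Base using (List; []; _∷_; _++_; [_]; map; concatMap; filter; length; allFin; tabulate; replicate)
import Data.List.Extrema.Nat as Extrema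
import Data.List.Properties as List
open import Data.List.Relation.Unary.All as All using (All; []; _∷_)
import Data.List.Relation.Unary.All.Properties as All
open import Data.List.Relation.Unary.AllPairs using (AllPairs; []; _∷_)
import Data.List.Relation.Unary.AllPairs.Properties as AllPairs
open import Data.Nat.Base as ℕ using (ℕ; zero; suc; _+_; _*_; _^_; _≤_; _<_; _>_; _≥_; z≤n; s≤s)
import Data.Nat.Properties as ℕ
import Data.Nat.Tactic.RingSolver as ℕ-ring
open import Data.Product.Base using (_×_; _,_; ∃-syntax; Σ-syntax; proj₁; proj₂)
open import Data.Sum.Base using (_⊎_; inj₁; inj₂)
open import Data.Unit.Base using (⊤; tt)
open import Data.Vec.Functional using (Vector)
open import Function.Base using (_∘_; id; _$_)
open import Function.Bundles using (Equivalence)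
open import Relation.Binary.PropositionalEquality using (_≡_; _≢_; refl; sym; trans; cong; cong₂; subst; subst₂; module ≡-Reasoning)
open import Relation.Binary.Structures using (IsStrictTotalOrder)
open import Relation.Nullary.Decidable.Core using (Dec; yes; no; does; True; toWitness)
open import Relation.Unary using (Decidable)
open import Algebra.Properties.Monoid.Sum ℕ.+-0-monoid
  using () renaming (sum to sumℕ; sum-init-last to sumℕ-init-last; sum-cong-≗ to sumℕ-cong)
open import Algebra.Properties.Monoid.Sum ℤ.+-0-monoid
  using () renaming (sum to sumℤ; sum-cong-≗ to sumℤ-cong)
open import Defs
open State

-- `R` evolves without looking at the input. It is therefore the same on all paths at a given row
-- and need not be remembered by a node, although its range grows like `2 ^ n`; only `p`
-- distinguishes nodes. The size of the window comes from a fixed point. A row moves `p` by at most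
-- kW and then doubles its distance from `B`, so a distance d can never be made up again once 2 (d -
-- kW) ≥ d, that is, d ≥ 2kW. This gives `B` = 2kW and a window reaching about `B` to either side.
-- Above the window the carry costs one unit more, which the strict inequality pays for. Each layer
-- gets all its 2B nodes, reachable or not. The code of a successor is then a base address plus `p`,
-- and a machine without multiplication or division can print the records in order without exploring
-- the graph. Finding `p` amounts to dividing T by `K`, yet T is unbounded in terms of k and W. The
-- search stops after `M` + 1 rounds; if nothing is found by then, `p` lies above the window and the
-- root is a sink.

-- Lists

tabulate-+ : ∀ {A : Set} m {n} (f : Fin (m + n) → A) →
             tabulate f ≡ tabulate (f ∘ (_↑ˡ n)) ++ tabulate (f ∘ (m ↑ʳ_))
tabulate-+ zero    f = refl
tabulate-+ (suc m) f = cong (f zero ∷_) (tabulate-+ m (f ∘ suc))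

tabulate-const : ∀ {A : Set} m {a : A} → tabulate {n = m} (λ _ → a) ≡ replicate m a
tabulate-const zero    = refl
tabulate-const (suc m) = cong (_ ∷_) (tabulate-const m)

filter-map-length : ∀ {A B : Set} {P : B → Set} (P? : Decidable P) (f : A → B) xs →
                    length (filter (P? ∘ f) xs) ≡ length (filter P? (map f xs))
filter-map-length P? f []       = refl
filter-map-length P? f (x ∷ xs) with does (P? (f x))
... | true  = cong suc (filter-map-length P? f xs)
... | false = filter-map-length P? f xs

concatFrom : ∀ {A : Set} → (ℕ → List A) → ℕ → ℕ → List A
concatFrom g s zero    = []
concatFrom g s (suc c) = g s ++ concatFrom g (suc s) c

concatMap-tabulate : ∀ {A B : Set} (g : B → List A) (h : ℕ → List A) s m (f : Fin m → B) →
                     (∀ i → g (f i) ≡ h (s + toℕ i)) →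
                     concatMap g (tabulate f) ≡ concatFrom h s m
concatMap-tabulate g h s zero    f eq = refl
concatMap-tabulate g h s (suc m) f eq =
  cong₂ _++_ (trans (eq zero) (cong h (ℕ.+-identityʳ s)))
             (concatMap-tabulate g h (suc s) m (f ∘ suc)
               (λ i → trans (eq (suc i)) (cong h (ℕ.+-suc s (toℕ i)))))

-- Layered decision diagrams with a fixed window of states

shift : ∀ m {n} → Node n → Node (m + n)
shift m (sink b)  = sink b
shift m (inner v) = inner (m ↑ʳ v)

-- `carry` is the whole amount subtracted after the doubling that ends a row. In use it combines the
-- recentring by `B` with the actual carry of 0 or 1.
record Layer (k n : ℕ) : Set where
  constructor layer
  field
    var       : Variable k n
    remaining : ℕ
    carry     : ℤ

open Layer public

-- The first argument counts the columns of the row that are still unread.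
endColumn : ℕ → ℤ → ℤ → ℤ
endColumn zero    c p = p ℤ.+ p ℤ.- c
endColumn (suc _) c p = p

module Layered {k n : ℕ} (w : Vector ℤ k) (B M : ℕ) where

  open VariableOrder (interleavedOrder k n) using (_≺_)
  module ≺ = IsStrictTotalOrder (VariableOrder.isStrictTotalOrder (interleavedOrder k n))

  Layers : Set
  Layers = List (Layer k n)

  δ : Layer k n → ℤ → Bool → ℤ
  δ l p b = endColumn (remaining l) (carry l) (if b then p ℤ.- w (proj₂ (var l)) else p)

  run : Layers → Input k n → ℤ → ℤ
  run []       x p = p
  run (l ∷ ls) x p = run ls x (δ l p (valueAt x (var l)))

  accepts : Layers → Input k n → ℤ → Bool
  accepts ls x p = does (run ls x p ℤ.≤? + B)

  -- This justifies the early exits of `enter`: outside 1 ... `M` every continuation ends on the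
  -- same side of `B`. It is demanded of all nonempty suffixes because a path may leave the window
  -- at any layer.
  Safe : Layers → Set
  Safe []       = ⊤
  Safe (l ∷ ls) = (∀ x p → p ℤ.≤ 0ℤ → run (l ∷ ls) x p ℤ.≤ + B)
                × (∀ x p → p ℤ.> + M → run (l ∷ ls) x p ℤ.> + B)
                × Safe ls

  enter : ∀ (ls : Layers) → ℤ → Node (length ls * M)
  enter []       p        = sink (does (p ℤ.≤? + B))
  enter (l ∷ ls) -[1+ _ ] = sink true
  enter (l ∷ ls) (+ zero) = sink true
  enter (l ∷ ls) (+ suc p) with p ℕ.<? M
  ... | yes p<M = inner (fromℕ< p<M ↑ˡ (length ls * M))
  ... | no  p≮M = sink false

  -- Nodes are numbered layer by layer, so a suffix of the layers is itself a diagram occupying the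
  -- last numbers. Facts about edges thus become inductions on the layers.
  next : ∀ (ls : Layers) → Fin (length ls * M) → Bool → Node (length ls * M)
  next (l ∷ ls) v b with splitAt M v
  ... | inj₁ p = shift M (enter ls (δ l (+ suc (toℕ p)) b))
  ... | inj₂ u = shift M (next ls u b)

  variable-of : ∀ (ls : Layers) → Fin (length ls * M) → Variable k n
  variable-of (l ∷ ls) v with splitAt M v
  ... | inj₁ p = var l
  ... | inj₂ u = variable-of ls u

  next-↑ˡ : ∀ (l : Layer k n) (ls : Layers) p b → next (l ∷ ls) (p ↑ˡ (length ls * M)) b ≡
                         shift M (enter ls (δ l (+ suc (toℕ p)) b))
  next-↑ˡ l ls p b rewrite Fin.splitAt-↑ˡ M p (length ls * M) = refl

  next-↑ʳ : ∀ (l : Layer k n) (ls : Layers) u b → next (l ∷ ls) (M ↑ʳ u) b ≡ shift M (next ls u b)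
  next-↑ʳ l ls u b rewrite Fin.splitAt-↑ʳ M (length ls * M) u = refl

  variable-of-↑ˡ : ∀ (l : Layer k n) (ls : Layers) p → variable-of (l ∷ ls) (p ↑ˡ (length ls * M)) ≡ var l
  variable-of-↑ˡ l ls p rewrite Fin.splitAt-↑ˡ M p (length ls * M) = refl

  variable-of-↑ʳ : ∀ (l : Layer k n) (ls : Layers) u → variable-of (l ∷ ls) (M ↑ʳ u) ≡ variable-of ls u
  variable-of-↑ʳ l ls u rewrite Fin.splitAt-↑ʳ M (length ls * M) u = refl

  enter-label : ∀ {z} (ls : Layers) p {v : Fin (length ls * M)} → All ((z ≺_) ∘ var) ls → enter ls p ≡ inner v →
                z ≺ variable-of ls v
  enter-label {z} (l ∷ ls) (+ suc p) (z≺l ∷ _) eq with p ℕ.<? M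
  enter-label {z} (l ∷ ls) (+ suc p) (z≺l ∷ _) refl | yes p<M =
    subst (z ≺_) (sym (variable-of-↑ˡ l ls (fromℕ< p<M))) z≺l

  shift-ordered : ∀ {z} l (ls : Layers) (u : Node (length ls * M)) →
                  (∀ (v : Fin (length ls * M)) → u ≡ inner v → z ≺ variable-of ls v) →
                  ∀ (v : Fin (M + length ls * M)) → shift M u ≡ inner v → z ≺ variable-of (l ∷ ls) v
  shift-ordered {z} l ls (inner u) z≺ v refl =
    subst (z ≺_) (sym (variable-of-↑ʳ l ls u)) (z≺ u refl)

  Increasing : Layers → Set
  Increasing = AllPairs (λ l l′ → var l ≺ var l′)

  next-ordered : ∀ (ls : Layers) → Increasing ls →
                 ∀ (u : Fin (length ls * M)) b (v : Fin (length ls * M)) → next ls u b ≡ inner v → variable-of ls u ≺ variable-of ls v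
  next-ordered (l ∷ ls) (l≺ls ∷ inc) u b v eq with splitAt M u
  ... | inj₁ p  = shift-ordered l ls (enter ls (δ l (+ suc (toℕ p)) b))
                    (λ v′ → enter-label ls (δ l (+ suc (toℕ p)) b) l≺ls) v eq
  ... | inj₂ u′ = shift-ordered l ls (next ls u′ b) (next-ordered ls inc u′ b) v eq

  obdd : ∀ (ls : Layers) → Increasing ls → ℤ → OBDD (interleavedOrder k n)
  obdd ls inc p = record
    { #inner  = length ls * M
    ; label   = variable-of ls
    ; succ    = next ls
    ; root    = enter ls p
    ; ordered = next-ordered ls inc
    }

  -- The tail is closed under successors, so a path inside it survives the renumbering edge by edge.
  shift-path : ∀ {l} {ls : Layers} {p₀ p₁ x b} (inc : Increasing (l ∷ ls)) (inc′ : Increasing ls) {u : Node (length ls * M)} →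
               _⟨_⟩⇝_ (obdd ls inc′ p₀) u x b →
               _⟨_⟩⇝_ (obdd (l ∷ ls) inc p₁) (shift M u) x b
  shift-path inc inc′ stop = stop
  shift-path {l} {ls} {p₀} {p₁} {x} {b} inc inc′ (step {v = v} path) =
    step (subst (λ u → _⟨_⟩⇝_ (obdd (l ∷ ls) inc p₁) u x b)
           (sym (trans (cong (λ z → next (l ∷ ls) (M ↑ʳ v) (valueAt x z)) (variable-of-↑ʳ l ls v))
                       (next-↑ʳ l ls v _)))
           (shift-path {p₀ = p₀} {p₁} inc inc′ path))

  does-≤ : ∀ {p q : ℤ} → p ℤ.≤ q → does (p ℤ.≤? q) ≡ true
  does-≤ {p} {q} p≤q with p ℤ.≤? q
  ... | yes _ = refl
  ... | no ¬p = ⊥-elim (¬p p≤q)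

  does-> : ∀ {p q : ℤ} → p ℤ.> q → does (p ℤ.≤? q) ≡ false
  does-> {p} {q} p>q with p ℤ.≤? q
  ... | yes p≤q = ⊥-elim (ℤ.<⇒≱ p>q p≤q)
  ... | no _ = refl

  -- Where the window is left the path stops at once, and `Safe` tells on which side the full run
  -- would have ended. Inside the window one edge is followed and the induction continues in the
  -- tail.
  enter-path : ∀ (ls : Layers) (inc : Increasing ls) p₀ x p → Safe ls →
               _⟨_⟩⇝_ (obdd ls inc p₀) (enter ls p) x (accepts ls x p)
  enter-path [] inc p₀ x p safe = stop
  enter-path (l ∷ ls) inc p₀ x -[1+ p ] (low , _)
    rewrite does-≤ (low x -[1+ p ] ℤ.-≤+) = stop
  enter-path (l ∷ ls) inc p₀ x (+ zero) (low , _)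
    rewrite does-≤ (low x 0ℤ ℤ.≤-refl) = stop
  enter-path (l ∷ ls) inc@(_ ∷ inc′) p₀ x (+ suc p) (_ , high , safe) with p ℕ.<? M
  ... | no p≮M rewrite does-> (high x (+ suc p) (ℤ.+<+ (ℕ.s≤s (ℕ.≮⇒≥ p≮M)))) = stop
  ... | yes p<M = step (subst (λ u → _⟨_⟩⇝_ (obdd (l ∷ ls) inc p₀) u x (accepts (l ∷ ls) x (+ suc p)))
                     (sym (begin
                       next (l ∷ ls) v (valueAt x (variable-of (l ∷ ls) v))
                         ≡⟨ cong (λ z → next (l ∷ ls) v (valueAt x z)) (variable-of-↑ˡ l ls _) ⟩
                       next (l ∷ ls) v (valueAt x (var l))
                         ≡⟨ next-↑ˡ l ls _ _ ⟩
                       shift M (enter ls (δ l (+ suc (toℕ (fromℕ< p<M))) (valueAt x (var l))))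
                         ≡⟨ cong (λ q → shift M (enter ls (δ l (+ suc q) (valueAt x (var l))))) (Fin.toℕ-fromℕ< p<M) ⟩
                       shift M (enter ls (δ l (+ suc p) (valueAt x (var l)))) ∎))
                     (shift-path {p₀ = p₀} {p₀} inc inc′ (enter-path ls inc′ p₀ x _ safe)))
    where
    open ≡-Reasoning
    v = fromℕ< p<M ↑ˡ (length ls * M)

  -- Width

  labels : ∀ (ls : Layers) → map (variable-of ls) (allFin (length ls * M)) ≡
                  concatMap (λ l → replicate M (var l)) ls
  labels []       = refl
  labels (l ∷ ls) = begin
    map (variable-of (l ∷ ls)) (allFin (M + length ls * M))
      ≡⟨ List.map-tabulate (λ v → v) (variable-of (l ∷ ls)) ⟩
    tabulate (variable-of (l ∷ ls))
      ≡⟨ tabulate-+ M (variable-of (l ∷ ls)) ⟩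
    tabulate (variable-of (l ∷ ls) ∘ (_↑ˡ (length ls * M))) ++ tabulate (variable-of (l ∷ ls) ∘ (M ↑ʳ_))
      ≡⟨ cong₂ _++_ (trans (List.tabulate-cong (variable-of-↑ˡ l ls)) (tabulate-const M))
                    (trans (List.tabulate-cong (variable-of-↑ʳ l ls))
                           (sym (List.map-tabulate (λ v → v) (variable-of ls)))) ⟩
    replicate M (var l) ++ map (variable-of ls) (allFin (length ls * M))
      ≡⟨ cong (replicate M (var l) ++_) (labels ls) ⟩
    replicate M (var l) ++ concatMap (λ l → replicate M (var l)) ls ∎
    where open ≡-Reasoning

  occurrences : Variable k n → List (Variable k n) → ℕ
  occurrences z zs = length (filter (_≟ᵛ z) zs)

  occurrences-++ : ∀ z xs ys → occurrences z (xs ++ ys) ≡ occurrences z xs + occurrences z ys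
  occurrences-++ z xs ys =
    trans (cong length (List.filter-++ (_≟ᵛ z) xs ys)) (List.length-++ (filter (_≟ᵛ z) xs))

  occurrences-none : ∀ z (ls : Layers) → All ((_≢ z) ∘ var) ls →
                     occurrences z (concatMap (λ l → replicate M (var l)) ls) ≡ 0
  occurrences-none z []       []         = refl
  occurrences-none z (l ∷ ls) (l≢z ∷ ps) =
    trans (occurrences-++ z (replicate M (var l)) _)
          (cong₂ _+_ (cong length (List.filter-none (_≟ᵛ z) (All.replicate⁺ M l≢z)))
                     (occurrences-none z ls ps))

  -- By irreflexivity of the order, `Increasing` makes the labels of different layers distinct, so
  -- at most one block of `M` copies contributes.
  occurrences-≤ : ∀ z (ls : Layers) → Increasing ls →
                  occurrences z (concatMap (λ l → replicate M (var l)) ls) ≤ M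
  occurrences-≤ z []       inc = z≤n
  occurrences-≤ z (l ∷ ls) (l≺ls ∷ inc)
    rewrite occurrences-++ z (replicate M (var l)) (concatMap (λ l → replicate M (var l)) ls)
    with var l ≟ᵛ z
  ... | yes refl
    rewrite occurrences-none z ls (All.map (λ l≺ eq → ≺.irrefl (sym eq) l≺) l≺ls)
          | ℕ.+-identityʳ (occurrences z (replicate M z)) =
    ℕ.≤-trans (List.length-filter (_≟ᵛ z) (replicate M z)) (ℕ.≤-reflexive (List.length-replicate M))
  ... | no l≢z
    rewrite List.filter-none (_≟ᵛ z) (All.replicate⁺ {P = _≢ z} M l≢z) = occurrences-≤ z ls inc

  width-obdd : ∀ (ls : Layers) inc p → width (obdd ls inc p) ≤ M
  width-obdd ls inc p =
    Extrema.max≤v⁺ {v = M} {⊥ = 0} {xs = map (nodesLabelled D) (variables k n)} z≤n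
      (All.map⁺ (All.universal bound (variables k n)))
    where
    D = obdd ls inc p
    bound : ∀ z → nodesLabelled D z ≤ M
    bound z = ℕ.≤-trans (ℕ.≤-reflexive
      (trans (filter-map-length (_≟ᵛ z) (variable-of ls) (allFin (length ls * M)))
             (cong (occurrences z) (labels ls))))
      (occurrences-≤ z ls inc)

  -- Encoding of a layered diagram

  -- The window starts at p = 1, so base is one less than the code of the
  -- first node of ls.
  loBound hiBound : Layers → ℤ
  loBound []      = + B
  loBound (_ ∷ _) = 0ℤ
  hiBound []      = + B
  hiBound (_ ∷ _) = + M

  -- Behind the last layer both bounds equal `B`, the middle case is empty and only the sinks
  -- remain. The same three-way comparison therefore serves every layer, and one piece of program
  -- computes it.
  target : Layers → ℤ → ℤ → ℤ
  target ls base p = if does (p ℤ.≤? loBound ls) then 1ℤ else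
                     if does (p ℤ.≤? hiBound ls) then base ℤ.+ p else 0ℤ

  entries : ℕ → Layers → List ℤ
  entries base []       = []
  entries base (l ∷ ls) =
    concatFrom (λ p → (+ toℕ (proj₁ (var l))) ∷ (+ toℕ (proj₂ (var l)))
                    ∷ target ls (+ (base + M)) (δ l (+ p) false)
                    ∷ target ls (+ (base + M)) (δ l (+ p) true) ∷ []) 1 M
    ++ entries (base + M) ls

  -- `o` counts the inner nodes of the layers in front, so that a suffix can be encoded with the
  -- numbers it has in the whole diagram.
  code : ∀ {m} → ℕ → Node m → ℤ
  code o (sink b)  = encodeNode {0} (sink b)
  code o (inner v) = + (2 + (o + toℕ v))

  code-shift : ∀ o {m} (u : Node m) → code o (shift M u) ≡ code (o + M) u
  code-shift o (sink b)  = refl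
  code-shift o (inner v) = cong (λ a → + (2 + a))
    (trans (cong (o ℕ.+_) (Fin.toℕ-↑ʳ M v)) (sym (ℕ.+-assoc o M (toℕ v))))

  code-enter : ∀ o (ls : Layers) (p : ℤ) → code o (enter ls p) ≡ target ls (+ (1 + o)) p
  code-enter o [] p with does (p ℤ.≤? + B)
  ... | true  = refl
  ... | false = refl
  code-enter o (l ∷ ls) -[1+ p ] = refl
  code-enter o (l ∷ ls) (+ zero) = refl
  code-enter o (l ∷ ls) (+ suc p) with p ℕ.<? M
  ... | yes p<M rewrite does-≤ (ℤ.+≤+ p<M)
                      | Fin.toℕ-↑ˡ (fromℕ< p<M) (length ls * M)
                      | Fin.toℕ-fromℕ< p<M = cong +_ (cong suc (sym (ℕ.+-suc o p)))
  ... | no  p≮M rewrite does-> (ℤ.+<+ (ℕ.s≤s (ℕ.≮⇒≥ p≮M))) = refl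

  codes : ∀ (ls : Layers) → ℕ → Fin (length ls * M) → List ℤ
  codes ls o v = (+ toℕ (proj₁ (variable-of ls v))) ∷ (+ toℕ (proj₂ (variable-of ls v)))
               ∷ code o (next ls v false) ∷ code o (next ls v true) ∷ []

  codes-↑ˡ : ∀ (l : Layer k n) (ls : Layers) o p → codes (l ∷ ls) o (p ↑ˡ (length ls * M)) ≡
    (+ toℕ (proj₁ (var l))) ∷ (+ toℕ (proj₂ (var l)))
    ∷ target ls (+ (1 + o + M)) (δ l (+ suc (toℕ p)) false)
    ∷ target ls (+ (1 + o + M)) (δ l (+ suc (toℕ p)) true) ∷ []
  codes-↑ˡ l ls o p
    rewrite variable-of-↑ˡ l ls p | next-↑ˡ l ls p false | next-↑ˡ l ls p true
          | code-shift o (enter ls (δ l (+ suc (toℕ p)) false))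
          | code-shift o (enter ls (δ l (+ suc (toℕ p)) true))
          | code-enter (o + M) ls (δ l (+ suc (toℕ p)) false)
          | code-enter (o + M) ls (δ l (+ suc (toℕ p)) true) = refl

  codes-↑ʳ : ∀ (l : Layer k n) (ls : Layers) o u → codes (l ∷ ls) o (M ↑ʳ u) ≡ codes ls (o + M) u
  codes-↑ʳ l ls o u
    rewrite variable-of-↑ʳ l ls u | next-↑ʳ l ls u false | next-↑ʳ l ls u true
          | code-shift o (next ls u false) | code-shift o (next ls u true) = refl

  -- Node numbers run through the layers in order and through `p` within a layer, which is exactly
  -- the order in which nested loops print the records.
  concatMap-codes : ∀ (ls : Layers) o → concatMap (codes ls o) (allFin (length ls * M)) ≡ entries (1 + o) ls
  concatMap-codes []       o = refl
  concatMap-codes (l ∷ ls) o = begin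
    concatMap f (allFin (M + length ls * M))
      ≡⟨ cong (concatMap f) (tabulate-+ M (λ v → v)) ⟩
    concatMap f (tabulate (_↑ˡ (length ls * M)) ++ tabulate (M ↑ʳ_))
      ≡⟨ List.concatMap-++ f (tabulate {n = M} (_↑ˡ (length ls * M))) (tabulate (M ↑ʳ_)) ⟩
    concatMap f (tabulate (_↑ˡ (length ls * M))) ++ concatMap f (tabulate (M ↑ʳ_))
      ≡⟨ cong₂ _++_ (concatMap-tabulate f _ 1 M (_↑ˡ (length ls * M)) (codes-↑ˡ l ls o))
           (begin
             concatMap f (tabulate (M ↑ʳ_))
               ≡⟨ cong (concatMap f) (List.map-tabulate (λ v → v) (M ↑ʳ_)) ⟨
             concatMap f (map (M ↑ʳ_) (allFin (length ls * M)))
               ≡⟨ List.concatMap-map f (M ↑ʳ_) (allFin (length ls * M)) ⟩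
             concatMap (f ∘ (M ↑ʳ_)) (allFin (length ls * M))
               ≡⟨ List.concatMap-cong (codes-↑ʳ l ls o) (allFin (length ls * M)) ⟩
             concatMap (codes ls (o + M)) (allFin (length ls * M))
               ≡⟨ concatMap-codes ls (o + M) ⟩
             entries (1 + o + M) ls ∎) ⟩
    entries (1 + o) (l ∷ ls) ∎
    where
    open ≡-Reasoning
    f = codes (l ∷ ls) o

  encodeNode-code : ∀ {m} (u : Node m) → encodeNode u ≡ code 0 u
  encodeNode-code (sink false) = refl
  encodeNode-code (sink true)  = refl
  encodeNode-code (inner v)    = refl

  encode-obdd : ∀ (ls : Layers) inc p → encodeOBDD (obdd ls inc p) ≡ target ls 1ℤ p ∷ entries 1 ls
  encode-obdd ls inc p = cong₂ _∷_
    (trans (encodeNode-code (enter ls p)) (code-enter 0 ls p))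
    (trans (List.concatMap-cong (λ v → cong₂ (λ a b → (+ toℕ (proj₁ (variable-of ls v))) ∷ (+ toℕ (proj₂ (variable-of ls v))) ∷ a ∷ b ∷ [])
              (encodeNode-code (next ls v false)) (encodeNode-code (next ls v true)))
              (allFin (length ls * M)))
           (concatMap-codes ls 0))

-- Linear inequalities over ℤ: a ≤ b is derived by writing the gap b - a
-- as a sum of nonnegative terms, which leaves a ring identity.
gap : ∀ {a b} → a ℤ.≤ b → 0ℤ ℤ.≤ b ℤ.- a
gap = ℤ.i≤j⇒0≤j-i

infixl 6 _⊕_
_⊕_ : ∀ {a b} → 0ℤ ℤ.≤ a → 0ℤ ℤ.≤ b → 0ℤ ℤ.≤ a ℤ.+ b
_⊕_ = ℤ.+-mono-≤

fromGap : ∀ {a b e} → 0ℤ ℤ.≤ e → b ℤ.- a ≡ e → a ℤ.≤ b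
fromGap 0≤e eq = ℤ.0≤i-j⇒j≤i (subst (0ℤ ℤ.≤_) (sym eq) 0≤e)

gap< : ∀ {a b} → a ℤ.< b → 0ℤ ℤ.≤ b ℤ.- (1ℤ ℤ.+ a)
gap< a<b = gap (ℤ.i<j⇒suc[i]≤j a<b)

fromGap< : ∀ {a b e} → 0ℤ ℤ.≤ e → b ℤ.- (1ℤ ℤ.+ a) ≡ e → a ℤ.< b
fromGap< 0≤e eq = ℤ.suc[i]≤j⇒i<j (fromGap 0≤e eq)

0≤+ : ∀ a → 0ℤ ℤ.≤ + a
0≤+ a = ℤ.+≤+ z≤n

if-bit : ∀ b p v → (if b then p ℤ.- v else p) ≡ p ℤ.- v ℤ.* + bit b
if-bit true  p v = cong (λ u → p ℤ.- u) (sym (ℤ.*-identityʳ v))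
if-bit false p v = sym (trans (cong (λ u → p ℤ.- u) (ℤ.*-zeroʳ v)) (ℤ.+-identityʳ p))

-- Binary values and weighted sums

-- The recursion peels off the most significant bit, as the variable order does, whereas the sum
-- over `Fin` begins with the least significant one.
lowBits : ∀ {n} m → m ≤ n → Vector Bool n → ℕ
lowBits zero    _   x = 0
lowBits (suc m) m<n x = bit (x (fromℕ< m<n)) * 2 ^ m + lowBits m (ℕ.<⇒≤ m<n) x

lowBits-sum : ∀ {n} m (m≤n : m ≤ n) x →
              lowBits m m≤n x ≡ sumℕ (λ i → bit (x (inject≤ i m≤n)) * 2 ^ toℕ i)
lowBits-sum zero    _   x = refl
lowBits-sum {n} (suc m) m<n x = begin
  bit (x (fromℕ< m<n)) * 2 ^ m + lowBits m (ℕ.<⇒≤ m<n) x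
    ≡⟨ ℕ.+-comm (bit (x (fromℕ< m<n)) * 2 ^ m) _ ⟩
  lowBits m (ℕ.<⇒≤ m<n) x + bit (x (fromℕ< m<n)) * 2 ^ m
    ≡⟨ cong₂ _+_ (trans (lowBits-sum m _ x) (sumℕ-cong (λ i → cong₂ _*_
                   (cong (bit ∘ x) (Fin.toℕ-injective (begin
                     toℕ (inject≤ i (ℕ.<⇒≤ m<n))        ≡⟨ Fin.toℕ-inject≤ i _ ⟩
                     toℕ i                              ≡⟨ Fin.toℕ-inject₁ i ⟨
                     toℕ (inject₁ i)                    ≡⟨ Fin.toℕ-inject≤ (inject₁ i) m<n ⟨
                     toℕ (inject≤ (inject₁ i) m<n)      ∎)))
                   (cong (2 ^_) (sym (Fin.toℕ-inject₁ i))))))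
                 (cong₂ _*_ (cong (bit ∘ x) (Fin.toℕ-injective (begin
                     toℕ (fromℕ< m<n)                   ≡⟨ Fin.toℕ-fromℕ< m<n ⟩
                     m                                  ≡⟨ Fin.toℕ-fromℕ m ⟨
                     toℕ (fromℕ m)                      ≡⟨ Fin.toℕ-inject≤ (fromℕ m) m<n ⟨
                     toℕ (inject≤ (fromℕ m) m<n)        ∎)))
                   (cong (2 ^_) (sym (Fin.toℕ-fromℕ m)))) ⟩
  sumℕ (λ i → f (inject₁ i)) + f (fromℕ m)
    ≡⟨ sumℕ-init-last f ⟨
  sumℕ f ∎
  where
  open ≡-Reasoning
  f : Fin (suc m) → ℕ
  f i = bit (x (inject≤ i m<n)) * 2 ^ toℕ i

lowBits-all : ∀ {n} x → lowBits n ℕ.≤-refl x ≡ ∣ x ∣₂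
lowBits-all {n} x = trans (lowBits-sum n ℕ.≤-refl x)
  (sumℕ-cong (λ i → cong (λ j → bit (x j) * 2 ^ toℕ i)
    (Fin.toℕ-injective (Fin.toℕ-inject≤ i ℕ.≤-refl))))

-- Used with `P` = `2 ^ m` to separate the top bits of all vectors from their lower bits.
sum-scale : ∀ {k} (w : Vector ℤ k) (P : ℕ) (u v : Fin k → ℕ) →
            sumℤ (λ j → w j ℤ.* + (u j * P + v j)) ≡
            + P ℤ.* sumℤ (λ j → w j ℤ.* + u j) ℤ.+ sumℤ (λ j → w j ℤ.* + v j)
sum-scale {zero}  w P u v = sym (trans (ℤ.+-identityʳ _) (ℤ.*-zeroʳ (+ P)))
sum-scale {suc k} w P u v = begin
  w zero ℤ.* + (u zero * P + v zero) ℤ.+ sumℤ (λ j → w (suc j) ℤ.* + (u (suc j) * P + v (suc j)))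
    ≡⟨ cong₂ (λ a b → w zero ℤ.* (a ℤ.+ + v zero) ℤ.+ b) (ℤ.pos-* (u zero) P)
             (sum-scale (w ∘ suc) P (u ∘ suc) (v ∘ suc)) ⟩
  w zero ℤ.* (+ u zero ℤ.* + P ℤ.+ + v zero) ℤ.+ (+ P ℤ.* Σu ℤ.+ Σv)
    ≡⟨ ring (w zero) (+ u zero) (+ P) (+ v zero) Σu Σv ⟩
  + P ℤ.* (w zero ℤ.* + u zero ℤ.+ Σu) ℤ.+ (w zero ℤ.* + v zero ℤ.+ Σv) ∎
  where
  open ≡-Reasoning
  Σu = sumℤ (λ j → w (suc j) ℤ.* + u (suc j))
  Σv = sumℤ (λ j → w (suc j) ℤ.* + v (suc j))
  ring : ∀ a u P v s t → a ℤ.* (u ℤ.* P ℤ.+ v) ℤ.+ (P ℤ.* s ℤ.+ t) ≡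
                         P ℤ.* (a ℤ.* u ℤ.+ s) ℤ.+ (a ℤ.* v ℤ.+ t)
  ring = solve-∀

-- The layers of a threshold function

module Threshold {k′ n : ℕ} (W : ℕ) (w : Vector ℤ (suc k′)) (K : ℕ) where

  k H B M : ℕ
  k = suc k′
  H = k * W
  B = H + H
  M = B + B

  open Layered {k} {n} w B M public
  open VariableOrder (interleavedOrder k n) using (_≺_)

  -- T = (p - B) K - R for the current threshold, so doubling the state at
  -- the end of a row doubles R modulo K and carries.
  carryOf nextRest : ℤ → ℤ
  carryOf  R = if does (+ K ℤ.- R ℤ.- R ℤ.≤? 0ℤ) then + B ℤ.+ 1ℤ else + B
  nextRest R = if does (+ K ℤ.- R ℤ.- R ℤ.≤? 0ℤ) then R ℤ.+ R ℤ.- + K else R ℤ.+ R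

  cols : ∀ c → (Fin c → Fin k) → Fin n → ℤ → Layers
  cols zero    g i b = []
  cols (suc c) g i b = layer (i , g zero) c b ∷ cols c (g ∘ suc) i b

  rows : ∀ m → m ≤ n → ℤ → Layers
  rows zero    _   R = []
  rows (suc m) m<n R = cols k id (fromℕ< m<n) (carryOf R) ++ rows m (ℕ.<⇒≤ m<n) (nextRest R)

  length-cols : ∀ c g i b → length (cols c g i b) ≡ c
  length-cols zero    g i b = refl
  length-cols (suc c) g i b = cong suc (length-cols c (g ∘ suc) i b)

  length-rows : ∀ m m≤n R → length (rows m m≤n R) ≡ m * k
  length-rows zero    _   R = refl
  length-rows (suc m) m<n R = trans (List.length-++ (cols k id (fromℕ< m<n) (carryOf R)))
    (cong₂ _+_ (length-cols k id (fromℕ< m<n) (carryOf R)) (length-rows m _ (nextRest R)))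

  all-cols : ∀ {P : Layer k n → Set} c g i b → (∀ c j → P (layer (i , g j) c b)) →
             All P (cols c g i b)
  all-cols zero    g i b p = []
  all-cols (suc c) g i b p = p c zero ∷ all-cols c (g ∘ suc) i b (λ c j → p c (suc j))

  rows-below : ∀ m m≤n R → All (λ l → toℕ (proj₁ (var l)) < m) (rows m m≤n R)
  rows-below zero    _   R = []
  rows-below (suc m) m<n R = All.++⁺
    (all-cols k id (fromℕ< m<n) (carryOf R) (λ _ _ → s≤s (ℕ.≤-reflexive (Fin.toℕ-fromℕ< m<n))))
    (All.map ℕ.m<n⇒m<1+n (rows-below m _ (nextRest R)))

  cols-increasing : ∀ c g i b → (∀ {j j′} → j Fin.< j′ → g j Fin.< g j′) →
                    Increasing (cols c g i b)
  cols-increasing zero    g i b mono = []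
  cols-increasing (suc c) g i b mono =
    all-cols c (g ∘ suc) i b (λ _ j → inj₂ (refl , mono (s≤s z≤n)))
    ∷ cols-increasing c (g ∘ suc) i b (λ j<j′ → mono (s≤s j<j′))

  rows-increasing : ∀ m m≤n R → Increasing (rows m m≤n R)
  rows-increasing zero    _   R = []
  rows-increasing (suc m) m<n R = AllPairs.++⁺
    (cols-increasing k id (fromℕ< m<n) (carryOf R) id)
    (rows-increasing m _ (nextRest R))
    (all-cols k id (fromℕ< m<n) (carryOf R) (λ _ _ →
      All.map (λ lt → inj₁ (ℕ.<-≤-trans lt (ℕ.≤-reflexive (sym (Fin.toℕ-fromℕ< m<n)))))
              (rows-below m (ℕ.<⇒≤ m<n) (nextRest R))))

  carry-bounds : ∀ R → (+ B ℤ.≤ carryOf R) × (carryOf R ℤ.≤ + B ℤ.+ 1ℤ)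
  carry-bounds R with does (+ K ℤ.- R ℤ.- R ℤ.≤? 0ℤ)
  ... | true  = ℤ.i≤i+j (+ B) 1ℤ , ℤ.≤-refl
  ... | false = ℤ.≤-refl , ℤ.i≤i+j (+ B) 1ℤ

  carry-rest : ∀ R → R ℤ.+ R ≡ (carryOf R ℤ.- + B) ℤ.* + K ℤ.+ nextRest R
  carry-rest R with does (+ K ℤ.- R ℤ.- R ℤ.≤? 0ℤ)
  ... | true  = ring (+ B) R (+ K)
    where ring : ∀ B R K → R ℤ.+ R ≡ (B ℤ.+ 1ℤ ℤ.- B) ℤ.* K ℤ.+ (R ℤ.+ R ℤ.- K)
          ring = solve-∀
  ... | false = ring (+ B) R (+ K)
    where ring : ∀ B R K → R ℤ.+ R ≡ (B ℤ.- B) ℤ.* K ℤ.+ (R ℤ.+ R)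
          ring = solve-∀

  -- Kept apart from the upper bound: each of the two is preserved on its own, and a start outside
  -- the window supplies only one.
  nextRest-nonneg : ∀ R → 0ℤ ℤ.≤ R → 0ℤ ℤ.≤ nextRest R
  nextRest-nonneg R 0≤R with + K ℤ.- R ℤ.- R ℤ.≤? 0ℤ
  ... | yes le = fromGap (gap le) (ring (+ K) R)
    where ring : ∀ K R → R ℤ.+ R ℤ.- K ℤ.- 0ℤ ≡ 0ℤ ℤ.- (K ℤ.- R ℤ.- R)
          ring = solve-∀
  ... | no _ = 0≤R ⊕ 0≤R

  nextRest-< : ∀ R → R ℤ.< + K → nextRest R ℤ.< + K
  nextRest-< R R<K with + K ℤ.- R ℤ.- R ℤ.≤? 0ℤ
  ... | yes _ = fromGap< (gap< R<K ⊕ gap< R<K ⊕ 0≤+ 1) (ring (+ K) R)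
    where ring : ∀ K R → K ℤ.- (1ℤ ℤ.+ (R ℤ.+ R ℤ.- K)) ≡
                         (K ℤ.- (1ℤ ℤ.+ R)) ℤ.+ (K ℤ.- (1ℤ ℤ.+ R)) ℤ.+ 1ℤ
          ring = solve-∀
  ... | no nle = fromGap< (gap< (ℤ.≰⇒> nle)) (ring (+ K) R)
    where ring : ∀ K R → K ℤ.- (1ℤ ℤ.+ (R ℤ.+ R)) ≡ (K ℤ.- R ℤ.- R) ℤ.- (1ℤ ℤ.+ 0ℤ)
          ring = solve-∀

  column : Fin n → Input k n → ∀ {c} → (Fin c → Fin k) → ℤ
  column i x g = sumℤ (λ j → w (g j) ℤ.* + bit (x (g j) i))

  -- Stated for nonempty rows because the last column is the one that performs the doubling.
  run-cols : ∀ c g i b t x p → run (cols (suc c) g i b ++ t) x p ≡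
    run t x ((p ℤ.- column i x g) ℤ.+ (p ℤ.- column i x g) ℤ.- b)
  run-cols zero g i b t x p = cong (λ q → run t x (q ℤ.+ q ℤ.- b))
    (trans (if-bit (x (g zero) i) p (w (g zero)))
           (cong (λ u → p ℤ.- u) (sym (ℤ.+-identityʳ _))))
  run-cols (suc c) g i b t x p =
    trans (run-cols c (g ∘ suc) i b t x _)
          (cong (λ q → run t x (q ℤ.+ q ℤ.- b))
            (trans (cong (ℤ._- column i x (g ∘ suc)) (if-bit (x (g zero) i) p (w (g zero))))
                   (ring p (w (g zero) ℤ.* + bit (x (g zero) i)) (column i x (g ∘ suc)))))
    where ring : ∀ p u v → p ℤ.- u ℤ.- v ≡ p ℤ.- (u ℤ.+ v)
          ring = solve-∀

  restAfter : ℕ → ℤ → ℤ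
  restAfter zero    R = R
  restAfter (suc m) R = restAfter m (nextRest R)

  lowSum : ∀ m → m ≤ n → Input k n → ℤ
  lowSum m m≤n x = sumℤ (λ j → w j ℤ.* + lowBits m m≤n (x j))

  -- Put D = (p - B) K - R. By `carry-rest`, a row with column sum s turns D into 2 (D - K s). A bit
  -- of significance i is thus doubled i + 1 times after it is read, whence the factor 2K in front
  -- of `lowSum`.
  run-rows : ∀ m m≤n R x p →
    (run (rows m m≤n R) x p ℤ.- + B) ℤ.* + K ℤ.- restAfter m R ≡
    + (2 ^ m) ℤ.* ((p ℤ.- + B) ℤ.* + K ℤ.- R) ℤ.- (+ K ℤ.+ + K) ℤ.* lowSum m m≤n x
  run-rows zero m≤n R x p = trans (ring ((p ℤ.- + B) ℤ.* + K ℤ.- R) (+ K))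
    (cong (λ u → + 1 ℤ.* ((p ℤ.- + B) ℤ.* + K ℤ.- R) ℤ.- (+ K ℤ.+ + K) ℤ.* u)
          (sym (sum-zero w)))
    where
    ring : ∀ D K → D ≡ 1ℤ ℤ.* D ℤ.- (K ℤ.+ K) ℤ.* 0ℤ
    ring = solve-∀
    sum-zero : ∀ {c} (v : Vector ℤ c) → sumℤ (λ j → v j ℤ.* 0ℤ) ≡ 0ℤ
    sum-zero {zero}  v = refl
    sum-zero {suc c} v = cong₂ ℤ._+_ (ℤ.*-zeroʳ (v zero)) (sum-zero (v ∘ suc))
  run-rows (suc m) m<n R x p = begin
    (run (rows (suc m) m<n R) x p ℤ.- + B) ℤ.* + K ℤ.- restAfter m R′
      ≡⟨ cong (λ u → (u ℤ.- + B) ℤ.* + K ℤ.- restAfter m R′)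
              (run-cols k′ id (fromℕ< m<n) b (rows m _ R′) x p) ⟩
    (run (rows m _ R′) x p′ ℤ.- + B) ℤ.* + K ℤ.- restAfter m R′
      ≡⟨ run-rows m _ R′ x p′ ⟩
    + (2 ^ m) ℤ.* ((p′ ℤ.- + B) ℤ.* + K ℤ.- R′) ℤ.- (+ K ℤ.+ + K) ℤ.* S
      ≡⟨ cong (λ D → + (2 ^ m) ℤ.* D ℤ.- (+ K ℤ.+ + K) ℤ.* S) (begin
           (p′ ℤ.- + B) ℤ.* + K ℤ.- R′
             ≡⟨ ring₁ p s b (+ B) (+ K) R′ ⟩
           (p ℤ.- s ℤ.- + B) ℤ.* (+ K ℤ.+ + K) ℤ.- ((b ℤ.- + B) ℤ.* + K ℤ.+ R′)
             ≡⟨ cong (λ u → (p ℤ.- s ℤ.- + B) ℤ.* (+ K ℤ.+ + K) ℤ.- u) (carry-rest R) ⟨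
           (p ℤ.- s ℤ.- + B) ℤ.* (+ K ℤ.+ + K) ℤ.- (R ℤ.+ R) ∎) ⟩
    + (2 ^ m) ℤ.* ((p ℤ.- s ℤ.- + B) ℤ.* (+ K ℤ.+ + K) ℤ.- (R ℤ.+ R)) ℤ.- (+ K ℤ.+ + K) ℤ.* S
      ≡⟨ ring₂ (+ (2 ^ m)) p s (+ B) (+ K) R S ⟩
    (+ 2 ℤ.* + (2 ^ m)) ℤ.* ((p ℤ.- + B) ℤ.* + K ℤ.- R) ℤ.- (+ K ℤ.+ + K) ℤ.* (+ (2 ^ m) ℤ.* s ℤ.+ S)
      ≡⟨ cong₂ (λ u v → u ℤ.* ((p ℤ.- + B) ℤ.* + K ℤ.- R) ℤ.- (+ K ℤ.+ + K) ℤ.* v)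
           (sym (ℤ.pos-* 2 (2 ^ m)))
           (sym (sum-scale w (2 ^ m) (λ j → bit (x j (fromℕ< m<n))) (λ j → lowBits m (ℕ.<⇒≤ m<n) (x j)))) ⟩
    + (2 ^ suc m) ℤ.* ((p ℤ.- + B) ℤ.* + K ℤ.- R) ℤ.- (+ K ℤ.+ + K) ℤ.* lowSum (suc m) m<n x ∎
    where
    open ≡-Reasoning
    b = carryOf R
    R′ = nextRest R
    s = column (fromℕ< m<n) x id
    S = lowSum m (ℕ.<⇒≤ m<n) x
    p′ = (p ℤ.- s) ℤ.+ (p ℤ.- s) ℤ.- b
    ring₁ : ∀ p s b B K R′ → ((p ℤ.- s) ℤ.+ (p ℤ.- s) ℤ.- b ℤ.- B) ℤ.* K ℤ.- R′ ≡
            (p ℤ.- s ℤ.- B) ℤ.* (K ℤ.+ K) ℤ.- ((b ℤ.- B) ℤ.* K ℤ.+ R′)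
    ring₁ = solve-∀
    ring₂ : ∀ P p s B K R S →
      P ℤ.* ((p ℤ.- s ℤ.- B) ℤ.* (K ℤ.+ K) ℤ.- (R ℤ.+ R)) ℤ.- (K ℤ.+ K) ℤ.* S ≡
      (+ 2 ℤ.* P) ℤ.* ((p ℤ.- B) ℤ.* K ℤ.- R) ℤ.- (K ℤ.+ K) ℤ.* (P ℤ.* s ℤ.+ S)
    ring₂ = solve-∀

  -- A threshold too small or too large for the search leaves R out of
  -- range, but then the root is a sink and one bound on R suffices.
  Start : ℤ → ℤ → Set
  Start p R = (0ℤ ℤ.≤ R × R ℤ.< + K) ⊎ (0ℤ ℤ.≤ R × p ℤ.≤ 0ℤ) ⊎ (R ℤ.< + K × p ℤ.> + M)

  restAfter-nonneg : ∀ m R → 0ℤ ℤ.≤ R → 0ℤ ℤ.≤ restAfter m R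
  restAfter-nonneg zero    R 0≤R = 0≤R
  restAfter-nonneg (suc m) R 0≤R = restAfter-nonneg m _ (nextRest-nonneg R 0≤R)

  restAfter-< : ∀ m R → R ℤ.< + K → restAfter m R ℤ.< + K
  restAfter-< zero    R R<K = R<K
  restAfter-< (suc m) R R<K = restAfter-< m _ (nextRest-< R R<K)

  below : ∀ p R → 0ℤ ℤ.≤ R → p ℤ.≤ + B → (p ℤ.- + B) ℤ.* + K ℤ.- R ℤ.≤ 0ℤ
  below p R 0≤R p≤B = fromGap
    (subst (ℤ._≤ (+ B ℤ.- p) ℤ.* + K) (ℤ.*-zeroˡ (+ K)) (ℤ.*-monoʳ-≤-nonNeg (+ K) (gap p≤B)) ⊕ 0≤R)
    (ring p R (+ B) (+ K))
    where ring : ∀ p R B K → 0ℤ ℤ.- ((p ℤ.- B) ℤ.* K ℤ.- R) ≡ (B ℤ.- p) ℤ.* K ℤ.+ R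
          ring = solve-∀

  -- As `p` is an integer, `p > B` makes the product at least `K`, which exceeds `R`. Together with
  -- `below`, this lets `p` alone decide the sign.
  above : ∀ p R → R ℤ.< + K → p ℤ.> + B → (p ℤ.- + B) ℤ.* + K ℤ.- R ℤ.> 0ℤ
  above p R R<K p>B = fromGap<
    (subst (ℤ._≤ (p ℤ.- (1ℤ ℤ.+ + B)) ℤ.* + K) (ℤ.*-zeroˡ (+ K)) (ℤ.*-monoʳ-≤-nonNeg (+ K) (gap< p>B)) ⊕ gap< R<K)
    (ring p R (+ B) (+ K))
    where ring : ∀ p R B K → (p ℤ.- B) ℤ.* K ℤ.- R ℤ.- (1ℤ ℤ.+ 0ℤ) ≡
                 (p ℤ.- (1ℤ ℤ.+ B)) ℤ.* K ℤ.+ (K ℤ.- (1ℤ ℤ.+ R))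
          ring = solve-∀

  -- The initial position of the window

  -- Division by repeated addition with a number of rounds fixed in advance; nothing changes once
  -- `R` is nonnegative. The condition is a sign test because that is what the machine can branch
  -- on.
  seek : ℕ → ℤ × ℤ → ℤ × ℤ
  seek zero    s       = s
  seek (suc c) (p , R) =
    seek c (if does (0ℤ ℤ.- R ℤ.≤? 0ℤ) then (p , R) else (p ℤ.+ 1ℤ , R ℤ.+ + K))

  -- The cases are: position found, threshold below the window, search still running. In the last
  -- case the equation makes an exhausted search end at `p` = `M` + 1, just outside.
  Seeking : ℕ → ℤ × ℤ → Set
  Seeking c (p , R) = (0ℤ ℤ.≤ R × R ℤ.< + K) ⊎ (0ℤ ℤ.≤ R × p ℤ.≤ 0ℤ)
                    ⊎ (R ℤ.< 0ℤ × p ℤ.+ + c ≡ + suc M)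

  seek-start : ∀ c s → Seeking c s → let (p , R) = seek c s in Start p R
  seek-start zero s (inj₁ h) = inj₁ h
  seek-start zero s (inj₂ (inj₁ h)) = inj₂ (inj₁ h)
  seek-start zero s (inj₂ (inj₂ (R<0 , p≡))) =
    inj₂ (inj₂ (ℤ.<-≤-trans R<0 (0≤+ K) ,
                subst (+ M ℤ.<_) (trans (sym p≡) (ℤ.+-identityʳ _)) (ℤ.+<+ ℕ.≤-refl)))
  seek-start (suc c) (p , R) h with 0ℤ ℤ.- R ℤ.≤? 0ℤ
  ... | yes le = seek-start c (p , R) (keep h)
    where
    0≤R : 0ℤ ℤ.≤ R
    0≤R = ℤ.i-j≤0⇒i≤j le
    keep : Seeking (suc c) (p , R) → Seeking c (p , R)
    keep (inj₁ h) = inj₁ h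
    keep (inj₂ (inj₁ h)) = inj₂ (inj₁ h)
    keep (inj₂ (inj₂ (R<0 , _))) = ⊥-elim (ℤ.<⇒≱ R<0 0≤R)
  ... | no nle = seek-start c (p ℤ.+ 1ℤ , R ℤ.+ + K) (advance h)
    where
    R<0 : R ℤ.< 0ℤ
    R<0 = ℤ.≰⇒> (λ 0≤R → nle (ℤ.i≤j⇒i-j≤0 0≤R))
    advance : Seeking (suc c) (p , R) → Seeking c (p ℤ.+ 1ℤ , R ℤ.+ + K)
    advance (inj₁ (0≤R , _)) = ⊥-elim (ℤ.<⇒≱ R<0 0≤R)
    advance (inj₂ (inj₁ (0≤R , _))) = ⊥-elim (ℤ.<⇒≱ R<0 0≤R)
    advance (inj₂ (inj₂ (_ , p≡))) with 0ℤ ℤ.≤? R ℤ.+ + K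
    ... | yes 0≤R+K = inj₁ (0≤R+K , subst (R ℤ.+ + K ℤ.<_) (ℤ.+-identityˡ (+ K)) (ℤ.+-monoˡ-< (+ K) R<0))
    ... | no  ¬0≤   = inj₂ (inj₂ (ℤ.≰⇒> ¬0≤ , trans (ring p (+ c)) p≡))
      where ring : ∀ p c → p ℤ.+ 1ℤ ℤ.+ c ≡ p ℤ.+ (1ℤ ℤ.+ c)
            ring = solve-∀

  seek-value : ∀ (c : ℕ) (s : ℤ × ℤ) → let (p , R) = s; (p′ , R′) = seek c s in
    (p′ ℤ.- + B) ℤ.* + K ℤ.- R′ ≡ (p ℤ.- + B) ℤ.* + K ℤ.- R
  seek-value zero    s       = refl
  seek-value (suc c) (p , R) with does (0ℤ ℤ.- R ℤ.≤? 0ℤ)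
  ... | true  = seek-value c (p , R)
  ... | false = trans (seek-value c (p ℤ.+ 1ℤ , R ℤ.+ + K)) (ring p R (+ B) (+ K))
    where ring : ∀ p R B K → (p ℤ.+ 1ℤ ℤ.- B) ℤ.* K ℤ.- (R ℤ.+ K) ≡ (p ℤ.- B) ℤ.* K ℤ.- R
          ring = solve-∀

  -- Position 0 is the last one below the window. If the remainder is already nonnegative there,
  -- then T ≤ -BK and the search never moves.
  origin : ℤ → ℤ × ℤ
  origin T = 0ℤ , 0ℤ ℤ.- T ℤ.- + B ℤ.* + K

  origin-seeking : ∀ T → Seeking (suc M) (origin T)
  origin-seeking T with 0ℤ ℤ.≤? proj₂ (origin T)
  ... | yes 0≤R = inj₂ (inj₁ (0≤R , ℤ.≤-refl))
  ... | no  0≰R = inj₂ (inj₂ (ℤ.≰⇒> 0≰R , refl))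

  origin-value : ∀ T → (0ℤ ℤ.- + B) ℤ.* + K ℤ.- proj₂ (origin T) ≡ T
  origin-value T = ring T (+ B) (+ K)
    where ring : ∀ T B K → (0ℤ ℤ.- B) ℤ.* K ℤ.- (0ℤ ℤ.- T ℤ.- B ℤ.* K) ≡ T
          ring = solve-∀

  -- Outcomes decided outside the window, and correctness of the diagram

  module Bounded (bounded : WeightsBoundedBy W w) where

    -- How far from B the state must be, with c columns of the row
    -- remaining, for the outcome to be decided.
    slack : ℕ → ℕ
    slack zero    = H
    slack (suc c) = slack c + W

    slack-≤ : ∀ c → c ≤ k → slack c ≤ B
    slack-≤ c c≤k = ℕ.≤-trans (ℕ.≤-reflexive (closed c)) (ℕ.+-monoʳ-≤ H (ℕ.*-monoˡ-≤ W c≤k))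
      where
      closed : ∀ c → slack c ≡ H + c * W
      closed zero    = sym (ℕ.+-identityʳ H)
      closed (suc c) = trans (cong (_+ W) (closed c))
        (trans (ℕ.+-assoc H (c * W) W) (cong (H ℕ.+_) (ℕ.+-comm (c * W) W)))

    move-≤ : ∀ β p j → (if β then p ℤ.- w j else p) ℤ.≤ p ℤ.+ + W
    move-≤ true  p j = fromGap (gap (proj₁ (bounded j))) (ring p (w j) (+ W))
      where ring : ∀ p v W → p ℤ.+ W ℤ.- (p ℤ.- v) ≡ v ℤ.- (ℤ.- W)
            ring = solve-∀
    move-≤ false p j = ℤ.i≤i+j p (+ W)

    move-≥ : ∀ β p j → p ℤ.- + W ℤ.≤ (if β then p ℤ.- w j else p)
    move-≥ true  p j = fromGap (gap (proj₂ (bounded j))) (ring p (w j) (+ W))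
      where ring : ∀ p v W → p ℤ.- v ℤ.- (p ℤ.- W) ≡ W ℤ.- v
            ring = solve-∀
    move-≥ false p j = ℤ.i-j≤i p (+ W)

    Low High : Layers → Set
    Low  t = ∀ x p → p ℤ.≤ 0ℤ → run t x p ℤ.≤ + B
    High t = ∀ x p → p ℤ.> + M → run t x p ℤ.> + B

    -- When the row ends, the slack is `H`, so p ≤ B - H = H. Doubling gives 2p - b ≤ 2H - B = 0,
    -- the hypothesis of `Low` for the rest.
    cols-low : ∀ c g i b t → + B ℤ.≤ b → Low t →
               ∀ x p → p ℤ.+ + slack (suc c) ℤ.≤ + B → run (cols (suc c) g i b ++ t) x p ℤ.≤ + B
    cols-low c g i b t B≤b low x p p≤ = go c refl
      where
      p′ = if x (g zero) i then p ℤ.- w (g zero) else p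
      p′≤ : p′ ℤ.+ + slack c ℤ.≤ + B
      p′≤ = fromGap (gap (move-≤ (x (g zero) i) p (g zero)) ⊕ gap p≤) (ring p p′ (+ slack c) (+ W) (+ B))
        where ring : ∀ p p′ s W B → B ℤ.- (p′ ℤ.+ s) ≡ (p ℤ.+ W ℤ.- p′) ℤ.+ (B ℤ.- (p ℤ.+ (s ℤ.+ W)))
              ring = solve-∀
      -- Splitting `c` here lets both cases share `p′` and its bound.
      go : ∀ c₁ → c₁ ≡ c → run (cols (suc c) g i b ++ t) x p ℤ.≤ + B
      go zero refl = low x _ (fromGap (gap p′≤ ⊕ gap p′≤ ⊕ gap B≤b) (ring p′ b (+ H)))
        where ring : ∀ p b H → 0ℤ ℤ.- (p ℤ.+ p ℤ.- b) ≡
                     (H ℤ.+ H ℤ.- (p ℤ.+ H)) ℤ.+ (H ℤ.+ H ℤ.- (p ℤ.+ H)) ℤ.+ (b ℤ.- (H ℤ.+ H))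
              ring = solve-∀
      go (suc c₁) refl = cols-low c₁ (g ∘ suc) i b t B≤b low x p′ p′≤

    -- When the row ends, p ≥ 3H + 1, while b ≤ 2H + 1 even with a carry. Hence 2p - b ≥ 4H + 1,
    -- which is above `M` again.
    cols-high : ∀ c g i b t → b ℤ.≤ + B ℤ.+ 1ℤ → High t →
                ∀ x p → + B ℤ.+ + slack (suc c) ℤ.< p → run (cols (suc c) g i b ++ t) x p ℤ.> + B
    cols-high c g i b t b≤ high x p <p = go c refl
      where
      p′ = if x (g zero) i then p ℤ.- w (g zero) else p
      <p′ : + B ℤ.+ + slack c ℤ.< p′
      <p′ = fromGap< (gap (move-≥ (x (g zero) i) p (g zero)) ⊕ gap< <p) (ring p p′ (+ slack c) (+ W) (+ B))
        where ring : ∀ p p′ s W B → p′ ℤ.- (1ℤ ℤ.+ (B ℤ.+ s)) ≡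
                     (p′ ℤ.- (p ℤ.- W)) ℤ.+ (p ℤ.- (1ℤ ℤ.+ (B ℤ.+ (s ℤ.+ W))))
              ring = solve-∀
      go : ∀ c₁ → c₁ ≡ c → run (cols (suc c) g i b ++ t) x p ℤ.> + B
      go zero refl = high x _ (fromGap< (gap< <p′ ⊕ gap< <p′ ⊕ gap b≤) (ring p′ b (+ H)))
        where ring : ∀ p b H → (p ℤ.+ p ℤ.- b) ℤ.- (1ℤ ℤ.+ ((H ℤ.+ H) ℤ.+ (H ℤ.+ H))) ≡
                     (p ℤ.- (1ℤ ℤ.+ (H ℤ.+ H ℤ.+ H))) ℤ.+ (p ℤ.- (1ℤ ℤ.+ (H ℤ.+ H ℤ.+ H)))
                     ℤ.+ (H ℤ.+ H ℤ.+ 1ℤ ℤ.- b)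
              ring = solve-∀
      go (suc c₁) refl = cols-high c₁ (g ∘ suc) i b t b≤ high x p′ <p′

    -- `Safe` says nothing about the empty list, but the last row still needs both bounds for what
    -- follows it.
    Tame : Layers → Set
    Tame t = Low t × High t × Safe t

    cols-tame : ∀ c g i b t → c ≤ k → + B ℤ.≤ b → b ℤ.≤ + B ℤ.+ 1ℤ → Tame t →
                Tame (cols c g i b ++ t)
    cols-tame zero    g i b t c≤k B≤b b≤ tame = tame
    cols-tame (suc c) g i b t c<k B≤b b≤ tame@(low , high , _) = low′ , high′ , low′ , high′ ,
      proj₂ (proj₂ (cols-tame c (g ∘ suc) i b t (ℕ.<⇒≤ c<k) B≤b b≤ tame))
      where
      slack≤B : + slack (suc c) ℤ.≤ + B
      slack≤B = ℤ.+≤+ (slack-≤ (suc c) c<k)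
      low′ : Low (cols (suc c) g i b ++ t)
      low′ x p p≤0 = cols-low c g i b t B≤b low x p (ℤ.+-mono-≤ p≤0 slack≤B)
      high′ : High (cols (suc c) g i b ++ t)
      high′ x p p>M = cols-high c g i b t b≤ high x p
        (ℤ.≤-<-trans (ℤ.+-monoʳ-≤ (+ B) slack≤B) p>M)

    rows-tame : ∀ m m≤n R → Tame (rows m m≤n R)
    rows-tame zero    _   R =
      (λ x p p≤0 → ℤ.≤-trans p≤0 (0≤+ B)) ,
      (λ x p p>M → ℤ.≤-<-trans (ℤ.+≤+ (ℕ.m≤m+n B B)) p>M) , tt
    rows-tame (suc m) m<n R =
      cols-tame k id (fromℕ< m<n) (carryOf R) (rows m _ (nextRest R)) ℕ.≤-refl
        (proj₁ (carry-bounds R)) (proj₂ (carry-bounds R)) (rows-tame m _ (nextRest R))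

    -- For a start outside the window `rows-tame` already fixes the side on which the run ends, and
    -- this side determines which bound on the remainder is needed.
    final : ∀ m m≤n R p → Start p R → ∀ x → let q = run (rows m m≤n R) x p in
      (q ℤ.≤ + B × (q ℤ.- + B) ℤ.* + K ℤ.- restAfter m R ℤ.≤ 0ℤ) ⊎
      (q ℤ.> + B × (q ℤ.- + B) ℤ.* + K ℤ.- restAfter m R ℤ.> 0ℤ)
    final m m≤n R p (inj₁ (0≤R , R<K)) x with run (rows m m≤n R) x p ℤ.≤? + B
    ... | yes q≤B = inj₁ (q≤B , below _ _ (restAfter-nonneg m R 0≤R) q≤B)
    ... | no  q≰B = inj₂ (ℤ.≰⇒> q≰B , above _ _ (restAfter-< m R R<K) (ℤ.≰⇒> q≰B))
    final m m≤n R p (inj₂ (inj₁ (0≤R , p≤0))) x = inj₁ (q≤B , below _ _ (restAfter-nonneg m R 0≤R) q≤B)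
      where q≤B = proj₁ (rows-tame m m≤n R) x p p≤0
    final m m≤n R p (inj₂ (inj₂ (R<K , p>M))) x = inj₂ (q>B , above _ _ (restAfter-< m R R<K) q>B)
      where q>B = proj₁ (proj₂ (rows-tame m m≤n R)) x p p>M

    -- With 2K = `2 ^ n` the identity of `run-rows` collapses to Δ = 2^n (T - S). So Δ has the sign
    -- of T - S, and `final` translates this sign into the test against `B`.
    accepts-threshold : ∀ {f : Input k n → Bool} {T} → IsThresholdOf T w f → K + K ≡ 2 ^ n →
      ∀ {p R} → (p ℤ.- + B) ℤ.* + K ℤ.- R ≡ T → Start p R →
      ∀ x → accepts (rows n ℕ.≤-refl R) x p ≡ f x
    accepts-threshold {f} {T} thr K+K {p} {R} T≡ start x = decide (f x) refl (final n ℕ.≤-refl R p start x)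
      where
      q = run (rows n ℕ.≤-refl R) x p
      Δ = (q ℤ.- + B) ℤ.* + K ℤ.- restAfter n R
      S = sumℤ (λ j → w j ℤ.* (+ ∣ x j ∣₂))
      S≡ : lowSum n ℕ.≤-refl x ≡ S
      S≡ = sumℤ-cong (λ j → cong (λ u → w j ℤ.* + u) (lowBits-all (x j)))
      Δ≡ : Δ ≡ + (2 ^ n) ℤ.* (T ℤ.- S)
      Δ≡ = begin
        Δ ≡⟨ run-rows n ℕ.≤-refl R x p ⟩
        + (2 ^ n) ℤ.* ((p ℤ.- + B) ℤ.* + K ℤ.- R) ℤ.- + (K + K) ℤ.* lowSum n ℕ.≤-refl x
          ≡⟨ cong₂ (λ u v → + (2 ^ n) ℤ.* u ℤ.- v) T≡ (cong₂ (λ u v → + u ℤ.* v) K+K S≡) ⟩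
        + (2 ^ n) ℤ.* T ℤ.- + (2 ^ n) ℤ.* S ≡⟨ ring (+ (2 ^ n)) T S ⟩
        + (2 ^ n) ℤ.* (T ℤ.- S) ∎
        where
        open ≡-Reasoning
        ring : ∀ P T S → P ℤ.* T ℤ.- P ℤ.* S ≡ P ℤ.* (T ℤ.- S)
        ring = solve-∀
      instance
        2^n-pos : ℤ.Positive (+ (2 ^ n))
        2^n-pos = ℤ.positive (ℤ.+<+ (ℕ.m^n>0 2 n))
      decide : ∀ b → f x ≡ b → _ → accepts (rows n ℕ.≤-refl R) x p ≡ b
      decide true  fx (inj₁ (q≤B , _)) = does-≤ q≤B
      decide true  fx (inj₂ (_ , Δ>0)) = ⊥-elim (ℤ.<⇒≱ Δ>0 (subst (ℤ._≤ 0ℤ) (sym Δ≡)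
        (subst (+ (2 ^ n) ℤ.* (T ℤ.- S) ℤ.≤_) (ℤ.*-zeroʳ (+ (2 ^ n)))
          (ℤ.*-monoˡ-≤-nonNeg (+ (2 ^ n)) (ℤ.i≤j⇒i-j≤0 (Equivalence.to (thr x) fx))))))
      decide false fx (inj₂ (q>B , _)) = does-> q>B
      decide false fx (inj₁ (_ , Δ≤0)) with () ← trans (sym fx) (Equivalence.from (thr x)
        (ℤ.i-j≤0⇒i≤j (ℤ.*-cancelˡ-≤-pos (T ℤ.- S) 0ℤ (+ (2 ^ n))
          (subst₂ ℤ._≤_ Δ≡ (sym (ℤ.*-zeroʳ (+ (2 ^ n)))) Δ≤0))))

-- Program runs with time bounds

-- Q may itself be a Runs statement about the remaining program, so that
-- the registers after straight-line code are computed by normalisation.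
Runs : Program → State → ℕ → (State → Set) → Set
Runs P σ t Q = ∃[ τ ] ∃[ s ] ⟨ P , σ ⟩⇓⟨ τ , s ⟩ × s ≤ t × Q τ

module _ {Q : State → Set} where

  run-skip : ∀ {σ} → Q σ → Runs skip σ 1 Q
  run-skip q = _ , _ , ⇓skip , ℕ.≤-refl , q

  run-reg : ∀ {σ a e} → Q (setReg a (⟦ e ⟧ σ) σ) → Runs (reg a ≔ e) σ (1 + cost e) Q
  run-reg q = _ , _ , ⇓reg , ℕ.≤-refl , q

  run-mem : ∀ {σ e e′} → Q (setMem (⟦ e ⟧ σ) (⟦ e′ ⟧ σ) σ) →
            Runs (mem e ≔ e′) σ (1 + cost e + cost e′) Q
  run-mem q = _ , _ , ⇓mem , ℕ.≤-refl , q

  run-read : ∀ {σ a z is} → input σ ≡ z ∷ is → Q (setReg a z (record σ { input = is })) →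
             Runs (read a) σ 1 Q
  run-read eq q = _ , _ , ⇓read eq , ℕ.≤-refl , q

  run-write : ∀ {σ e} → Q (emit (⟦ e ⟧ σ) σ) → Runs (write e) σ (1 + cost e) Q
  run-write q = _ , _ , ⇓write , ℕ.≤-refl , q

  infixr 4 _then_
  _then_ : ∀ {P P′ σ s t} {A : State → Set} → Runs P σ s A → (∀ {τ} → A τ → Runs P′ τ t Q) →
           Runs (P ⨟ P′) σ (s + t) Q
  (τ , _ , ⇓P , ≤s , a) then rest with υ , _ , ⇓P′ , ≤t , q ← rest a =
    υ , _ , ⇓seq ⇓P ⇓P′ , ℕ.+-mono-≤ ≤s ≤t , q

  run-seq : ∀ {P P′ σ s t} → Runs P σ s (λ τ → Runs P′ τ t Q) → Runs (P ⨟ P′) σ (s + t) Q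
  run-seq r = r then id

  run-if : ∀ {e P P′ σ t} → (⟦ e ⟧ σ ℤ.> 0ℤ → Runs P σ t Q) → (⟦ e ⟧ σ ℤ.≤ 0ℤ → Runs P′ σ t Q) →
           Runs (if e >0then P else P′) σ (1 + cost e + t) Q
  run-if {e} {σ = σ} yes-branch no-branch with ⟦ e ⟧ σ ℤ.≤? 0ℤ
  ... | yes e≤0 with τ , _ , ⇓P , ≤t , q ← no-branch e≤0 =
    τ , _ , ⇓else e≤0 ⇓P , ℕ.+-monoʳ-≤ (1 + cost e) ≤t , q
  ... | no  e≰0 with τ , _ , ⇓P , ≤t , q ← yes-branch (ℤ.≰⇒> e≰0) =
    τ , _ , ⇓then (ℤ.≰⇒> e≰0) ⇓P , ℕ.+-monoʳ-≤ (1 + cost e) ≤t , q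

  infixr 4 _and_
  _and_ : ∀ {P σ t} {A : State → Set} → Runs P σ t A → (∀ {τ} → A τ → Q τ) → Runs P σ t Q
  (τ , s , ⇓P , ≤t , a) and f = τ , s , ⇓P , ≤t , f a

  relax : ∀ {P σ s t} → s ≤ t → Runs P σ s Q → Runs P σ t Q
  relax s≤t (τ , _ , ⇓P , ≤s , q) = τ , _ , ⇓P , ℕ.≤-trans ≤s s≤t , q

  within : ∀ {P σ s} t → {True (s ℕ.≤? t)} → Runs P σ s Q → Runs P σ t Q
  within t {ok} = relax (toWitness ok)

-- Each evaluation of the guard costs 2, including the last one, which fails.
for : ∀ c {P t} (I : ℕ → State → Set) → (∀ {m σ} → I m σ → regs σ c ≡ + m) →
      (∀ {m σ} → I (suc m) σ → Runs P σ t (I m)) →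
      ∀ m {σ} → I m σ → Runs (while reg c >0do P) σ (m * (2 + t) + 2) (I 0)
for c I counter body zero {σ} i =
  σ , _ , ⇓done (ℤ.≤-reflexive (counter i)) , ℕ.≤-refl , i
for c {P} {t} I counter body (suc m) {σ} i
  with τ , s , ⇓P , ≤t , i′ ← body i
  with υ , s′ , ⇓loop-rest , ≤t′ , i″ ← for c I counter body m i′ =
  υ , _ , ⇓loop (subst (ℤ._> 0ℤ) (sym (counter i)) (ℤ.+<+ (s≤s z≤n))) ⇓P ⇓loop-rest ,
  ℕ.≤-trans (ℕ.+-mono-≤ (ℕ.+-monoʳ-≤ 2 ≤t) ≤t′) (ℕ.≤-reflexive (sym (ℕ.+-assoc (2 + t) _ 2))) , i″

-- The program

rk rn rW rR rB rM rK ri rj rcount rcols rp rq rv rlo rhi rbase rcarry : ℕ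
rk = 0 ; rn = 1 ; rW = 2 ; rR = 3 ; rB = 4 ; rM = 5 ; rK = 6 ; ri = 7 ; rj = 8
rcount = 9 ; rcols = 10 ; rp = 11 ; rq = 12 ; rv = 13 ; rlo = 14 ; rhi = 15
rbase = 16 ; rcarry = 17

infix 5 _:=_
_:=_ : ℕ → Expr → Program
a := e = reg a ≔ e

store : Expr → Expr → Program
store e e′ = mem e ≔ e′

decr : ℕ → Program
decr c = c := reg c ⊟ lit 1ℤ

readWeight : Program
readWeight =
  decr rcount ⨟ read rv ⨟ store (reg rj) (reg rv) ⨟ rj := reg rj ⊞ lit 1ℤ ⨟
  rB := reg rB ⊞ (reg rW ⊞ reg rW)

double : Program
double = decr rcount ⨟ rK := reg rK ⊞ reg rK

subtract : Program
subtract = decr rcount ⨟ rR := reg rR ⊟ reg rK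

search : Program
search = decr rcount ⨟
  if lit 0ℤ ⊟ reg rR >0then (rp := reg rp ⊞ lit 1ℤ ⨟ rR := reg rR ⊞ reg rK) else skip

writeTarget : Program
writeTarget =
  if reg rq ⊟ reg rlo >0then
    (if reg rq ⊟ reg rhi >0then write (lit 0ℤ) else write (reg rbase ⊞ reg rq))
  else write (lit 1ℤ)

finishColumn : Program
finishColumn =
  -- The idle assignment makes both branches end with an update of `rq`, matching `endColumn` in
  -- either case.
  if reg rcols >0then (rq := reg rq) else (rq := reg rq ⊞ reg rq ⊟ reg rcarry)

writeEntry : Program
writeEntry =
  decr rcount ⨟ write (reg ri) ⨟ write (reg rj) ⨟
  rq := reg rp ⨟ finishColumn ⨟ writeTarget ⨟
  rq := reg rp ⊟ reg rv ⨟ finishColumn ⨟ writeTarget ⨟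
  rp := reg rp ⊞ lit 1ℤ

-- Both counters have been decremented by now, so their sum vanishes exactly when no layer follows.
setWindow : Program
setWindow =
  if reg rcols ⊞ reg ri >0then (rlo := lit 0ℤ ⨟ rhi := reg rM)
  else (rlo := reg rB ⨟ rhi := reg rB)

writeLayer : Program
writeLayer =
  -- `rbase` advances before any record is printed because inner successors lie in the next layer.
  decr rcols ⨟ rbase := reg rbase ⊞ reg rM ⨟ rv := mem (reg rj) ⨟ setWindow ⨟
  rp := lit 1ℤ ⨟ rcount := reg rM ⨟ while reg rcount >0do writeEntry ⨟
  rj := reg rj ⊞ lit 1ℤ

setCarry : Program
setCarry =
  if reg rK ⊟ reg rR ⊟ reg rR >0then
    (rcarry := reg rB ⨟ rR := reg rR ⊞ reg rR)
  else
    (rcarry := reg rB ⊞ lit 1ℤ ⨟ rR := reg rR ⊞ reg rR ⊟ reg rK)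

writeRow : Program
writeRow =
  decr ri ⨟ setCarry ⨟ rj := lit 0ℤ ⨟ rcols := reg rk ⨟
  while reg rcols >0do writeLayer

prepare : Program
prepare =
  read rk ⨟ read rn ⨟ read rW ⨟ read rR ⨟
  rcount := reg rk ⨟ while reg rcount >0do readWeight ⨟
  rM := reg rB ⊞ reg rB ⨟ rK := lit 1ℤ ⨟
  rcount := reg rn ⊟ lit 1ℤ ⨟ while reg rcount >0do double ⨟
  -- Together with the `B` subtractions that follow, this produces the remainder of `origin`; `rp`
  -- still holds its initial 0.
  rR := lit 0ℤ ⊟ reg rR ⨟
  rcount := reg rB ⨟ while reg rcount >0do subtract ⨟
  rcount := reg rM ⊞ lit 1ℤ ⨟ while reg rcount >0do search

construct : Program
construct =
  -- There is always a first layer, so the root is compared with the bounds 0 and `M`.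
  rlo := lit 0ℤ ⨟ rhi := reg rM ⨟ rbase := lit 1ℤ ⨟ rq := reg rp ⨟ writeTarget ⨟
  ri := reg rn ⨟ while reg ri >0do writeRow

decr-≡ : ∀ {a m} → a ≡ + suc m → a ℤ.- 1ℤ ≡ + m
decr-≡ refl = refl

-- Correctness of the printing phase

module Correct {k′ n : ℕ} (W : ℕ) (w : Vector ℤ (suc k′)) (K : ℕ) where
  open Threshold {k′} {n} W w K

  run-writeTarget : ∀ {Q : State → Set} {σ} ls base p →
    regs σ rlo ≡ loBound ls → regs σ rhi ≡ hiBound ls → regs σ rbase ≡ base → regs σ rq ≡ p →
    Q (emit (target ls base p) σ) → Runs writeTarget σ 12 Q
  run-writeTarget {Q} {σ} ls _ _ lo hi refl refl q with regs σ rq ℤ.≤? loBound ls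
  ... | yes p≤lo = within 12 (run-if {t = 8}
    (λ gt → ⊥-elim (ℤ.<⇒≱ gt (ℤ.i≤j⇒i-j≤0 (subst (regs σ rq ℤ.≤_) (sym lo) p≤lo))))
    (λ _ → within 8 (run-write q)))
  ... | no p≰lo with regs σ rq ℤ.≤? hiBound ls
  ... | yes p≤hi = within 12 (run-if {t = 8}
    (λ _ → within 8 (run-if {t = 4}
      (λ gt → ⊥-elim (ℤ.<⇒≱ gt (ℤ.i≤j⇒i-j≤0 (subst (regs σ rq ℤ.≤_) (sym hi) p≤hi))))
      (λ _ → run-write q)))
    (λ le → ⊥-elim (p≰lo (subst (regs σ rq ℤ.≤_) lo (ℤ.i-j≤0⇒i≤j le)))))
  ... | no p≰hi = within 12 (run-if {t = 8}
    (λ _ → within 8 (run-if {t = 4}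
      (λ _ → within 4 (run-write q))
      (λ le → ⊥-elim (p≰hi (subst (regs σ rq ℤ.≤_) hi (ℤ.i-j≤0⇒i≤j le))))))
    (λ le → ⊥-elim (p≰lo (subst (regs σ rq ℤ.≤_) lo (ℤ.i-j≤0⇒i≤j le)))))

  run-finishColumn : ∀ {Q : State → Set} {σ} c b p →
    regs σ rcols ≡ + c → regs σ rcarry ≡ b → regs σ rq ≡ p →
    Q (setReg rq (endColumn c b p) σ) → Runs finishColumn σ 8 Q
  run-finishColumn zero    _ _ c≡ refl refl q = run-if
    (λ gt → ⊥-elim (ℤ.<⇒≱ gt (ℤ.≤-reflexive c≡)))
    (λ _ → run-reg q)
  run-finishColumn (suc c) _ _ c≡ refl refl q = run-if
    (λ _ → within 6 (run-reg q))
    (λ le → ⊥-elim (ℤ.<⇒≱ (ℤ.+<+ (s≤s z≤n)) (subst (ℤ._≤ 0ℤ) c≡ le)))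

  Constants : State → Set
  Constants σ = regs σ rk ≡ + k × regs σ rB ≡ + B × regs σ rM ≡ + M × regs σ rK ≡ + K
              × (∀ j → memory σ (+ toℕ j) ≡ w j)

  InRow : ℕ → ℤ → ℤ → State → Set
  InRow i R b σ = Constants σ × regs σ ri ≡ + i × regs σ rR ≡ R × regs σ rcarry ≡ b

  InLayer : ℕ → ℤ → Layer k n → Layers → ℕ → State → Set
  InLayer i R l ls base σ =
    InRow i R (carry l) σ × regs σ rj ≡ + toℕ (proj₂ (var l)) × regs σ rcols ≡ + remaining l
    × regs σ rv ≡ w (proj₂ (var l)) × regs σ rlo ≡ loBound ls × regs σ rhi ≡ hiBound ls
    × regs σ rbase ≡ + base

  entry : Layer k n → Layers → ℕ → ℕ → List ℤ
  entry l ls base p = (+ toℕ (proj₁ (var l))) ∷ (+ toℕ (proj₂ (var l)))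
                    ∷ target ls (+ base) (δ l (+ p) false)
                    ∷ target ls (+ base) (δ l (+ p) true) ∷ []

  -- The invariant looks forward: what is written followed by what is still due equals a fixed
  -- `total`. `Columns` and `Rows` do the same, so the loops nest without splitting the output.
  Entries : ℤ → Layer k n → Layers → ℕ → List ℤ → ℕ → State → Set
  Entries R l ls base total m σ =
    regs σ rcount ≡ + m × InLayer (toℕ (proj₁ (var l))) R l ls base σ ×
    (∃[ p ] regs σ rp ≡ + p × output σ ++ (concatFrom (entry l ls base) p m ++ entries base ls) ≡ total)

  suc-≡ : ∀ {a p} → a ≡ + p → a ℤ.+ 1ℤ ≡ + suc p
  suc-≡ {p = p} refl = cong +_ (ℕ.+-comm p 1)

  run-writeEntry : ∀ {R l ls base total m σ} → Entries R l ls base total (suc m) σ →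
                   Runs writeEntry σ 68 (Entries R l ls base total m)
  run-writeEntry {R} {l} {ls} {base} {total} {m} {σ}
    (cnt , env@((_ , i≡ , _ , b≡) , j≡ , c≡ , v≡ , lo≡ , hi≡ , base≡) , p , p≡ , out) =
    within 68 $ run-seq $ run-reg $ run-seq $ run-write $ run-seq $ run-write $ run-seq $ run-reg $
    run-seq $ run-finishColumn (remaining l) (carry l) (+ p) c≡ b≡ p≡ $
    run-seq $ run-writeTarget ls (+ base) (δ l (+ p) false) lo≡ hi≡ base≡ refl $
    run-seq $ run-reg $
    run-seq $ run-finishColumn (remaining l) (carry l) (+ p ℤ.- w (proj₂ (var l))) c≡ b≡ (cong₂ ℤ._-_ p≡ v≡) $
    run-seq $ run-writeTarget ls (+ base) (δ l (+ p) true) lo≡ hi≡ base≡ refl $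
    run-reg (decr-≡ cnt , env , suc p , suc-≡ p≡ , out′)
    where
    rest = concatFrom (entry l ls base) (suc p) m ++ entries base ls
    out′ : ((((output σ ++ [ regs σ ri ]) ++ [ regs σ rj ]) ++ [ target ls (+ base) (δ l (+ p) false) ])
            ++ [ target ls (+ base) (δ l (+ p) true) ]) ++ rest ≡ total
    out′ rewrite i≡ | j≡ = trans (snoc₄ (output σ) rest) out
      where
      snoc₄ : ∀ (o r : List ℤ) {a b c d} →
              ((((o ++ [ a ]) ++ [ b ]) ++ [ c ]) ++ [ d ]) ++ r ≡ o ++ a ∷ b ∷ c ∷ d ∷ r
      snoc₄ o r {a} {b} {c} {d} =
        trans (List.++-assoc (((o ++ [ a ]) ++ [ b ]) ++ [ c ]) [ d ] r)
        (trans (List.++-assoc ((o ++ [ a ]) ++ [ b ]) [ c ] _)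
        (trans (List.++-assoc (o ++ [ a ]) [ b ] _) (List.++-assoc o [ a ] _)))

  Window : ℕ → Layers → Set
  Window m ls = (m ≡ 0 × loBound ls ≡ + B × hiBound ls ≡ + B)
              ⊎ (0 < m × loBound ls ≡ 0ℤ × hiBound ls ≡ + M)

  window-cols : ∀ c g i b {m t} → Window m t → Window (c + m) (cols c g i b ++ t)
  window-cols zero    g i b window = window
  window-cols (suc c) g i b window = inj₂ (s≤s z≤n , refl , refl)

  window-rows : ∀ m m≤n R → Window m (rows m m≤n R)
  window-rows zero    m≤n R = inj₁ (refl , refl , refl)
  window-rows (suc m) m≤n R = inj₂ (s≤s z≤n , refl , refl)

  run-setWindow : ∀ {Q : State → Set} {σ} c m ls → Window (c + m) ls →
    regs σ rcols ≡ + c → regs σ ri ≡ + m → regs σ rB ≡ + B → regs σ rM ≡ + M →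
    Q (setReg rhi (hiBound ls) (setReg rlo (loBound ls) σ)) → Runs setWindow σ 8 Q
  run-setWindow {Q} {σ} c m ls (inj₁ (c+m≡0 , lo , hi)) c≡ m≡ B≡ M≡ q = run-if
    (λ gt → ⊥-elim (ℤ.<⇒≱ gt (ℤ.≤-reflexive (trans (cong₂ ℤ._+_ c≡ m≡) (cong +_ c+m≡0)))))
    (λ _ → run-seq $ run-reg $ run-reg
      (subst₂ (λ u v → Q (setReg rhi u (setReg rlo v σ))) (trans hi (sym B≡)) (trans lo (sym B≡)) q))
  run-setWindow {Q} {σ} c m ls (inj₂ (0<c+m , lo , hi)) c≡ m≡ B≡ M≡ q = run-if
    (λ _ → run-seq $ run-reg $ run-reg
      (subst₂ (λ u v → Q (setReg rhi u (setReg rlo v σ))) (trans hi (sym M≡)) lo q))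
    (λ le → ⊥-elim (ℤ.<⇒≱ (ℤ.+<+ 0<c+m) (subst (ℤ._≤ 0ℤ) (cong₂ ℤ._+_ c≡ m≡) le)))

  -- `g` embeds the unread columns as in `cols`; being translation by `j`, it agrees with the
  -- register `rj`.
  Columns : Fin n → ℤ → ℤ → Layers → List ℤ → ℕ → State → Set
  Columns i R b t total c σ =
    regs σ rcols ≡ + c × InRow (toℕ i) R b σ ×
    Σ[ g ∈ (Fin c → Fin k) ] ∃[ j ] ∃[ base ]
      regs σ rj ≡ + j × (∀ a → toℕ (g a) ≡ j + toℕ a) × regs σ rbase ≡ + base
      × output σ ++ entries base (cols c g i b ++ t) ≡ total

  -- The cost is 23 before the loop, 68 + 2 per entry with its guard, 2 for the failing guard and 4
  -- for the final increment, grouped as `run-seq` adds them.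
  layerTime : ℕ
  layerTime = 23 + (M * 70 + 2 + 4)

  run-writeLayer : ∀ {i R b t total c σ} → Window (toℕ i) t → Columns i R b t total (suc c) σ →
                   Runs writeLayer σ layerTime (Columns i R b t total c)
  run-writeLayer {i} {R} {b} {t} {total} {c} {σ} window
    (c≡ , row@((_ , B≡ , M≡ , _ , weights) , i≡ , _) , g , j , base , j≡ , g≡ , base≡ , out) =
    run-seq $ run-reg $ run-seq $ run-reg $ run-seq $ run-reg $
    run-seq $ run-setWindow c (toℕ i) ls (window-cols c (g ∘ suc) i b window) (decr-≡ c≡) i≡ B≡ M≡ $
    run-seq $ run-reg $ run-seq $ run-reg $
    loop then λ { (_ , (row′ , j≡′ , c≡′ , _ , _ , _ , base≡′) , _ , _ , out′) →
      run-reg (c≡′ , row′ , g ∘ suc , suc j , base + M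
              , suc-≡ (trans j≡′ (cong +_ (trans (g≡ zero) (ℕ.+-identityʳ j))))
              , (λ a → trans (g≡ (suc a)) (ℕ.+-suc j (toℕ a))) , base≡′ , out′) }
    where
    l = layer (i , g zero) c b
    ls = cols c (g ∘ suc) i b ++ t
    σ₁ σ₂ : State
    σ₁ = setReg rv (memory σ (regs σ rj)) (setReg rbase (regs σ rbase ℤ.+ regs σ rM)
         (setReg rcols (regs σ rcols ℤ.- 1ℤ) σ))
    σ₂ = setReg rcount (regs σ rM) (setReg rp 1ℤ (setReg rhi (hiBound ls) (setReg rlo (loBound ls) σ₁)))
    j≡g₀ : regs σ rj ≡ + toℕ (g zero)
    j≡g₀ = trans j≡ (cong +_ (sym (trans (g≡ zero) (ℕ.+-identityʳ j))))
    start : Entries R l ls (base + M) total M σ₂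
    start = M≡
      , (row , j≡g₀ , decr-≡ c≡ , trans (cong (memory σ) j≡g₀) (weights (g zero)) , refl , refl
        , cong₂ ℤ._+_ base≡ M≡)
      , 1 , refl , out
    loop : Runs (while reg rcount >0do writeEntry) σ₂ (M * 70 + 2) (Entries R l ls (base + M) total 0)
    loop = for rcount (Entries R l ls (base + M) total) proj₁ run-writeEntry M start

  run-setCarry : ∀ {Q : State → Set} {σ} R → regs σ rR ≡ R → regs σ rB ≡ + B → regs σ rK ≡ + K →
    Q (setReg rR (nextRest R) (setReg rcarry (carryOf R) σ)) → Runs setCarry σ 16 Q
  run-setCarry {Q} {σ} R refl B≡ K≡ q with + K ℤ.- R ℤ.- R ℤ.≤? 0ℤ
  ... | yes le = run-if
    (λ gt → ⊥-elim (ℤ.<⇒≱ gt (subst (λ u → u ℤ.- R ℤ.- R ℤ.≤ 0ℤ) (sym K≡) le)))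
    (λ _ → run-seq $ run-reg $ run-reg
      (subst₂ (λ u v → Q (setReg rR (R ℤ.+ R ℤ.- u) (setReg rcarry (v ℤ.+ 1ℤ) σ))) (sym K≡) (sym B≡) q))
  ... | no nle = run-if
    (λ _ → within 10 $ run-seq $ run-reg $ run-reg
      (subst (λ v → Q (setReg rR (R ℤ.+ R) (setReg rcarry v σ))) (sym B≡) q))
    (λ le → ⊥-elim (nle (subst (λ u → u ℤ.- R ℤ.- R ℤ.≤ 0ℤ) K≡ le)))

  Rows : List ℤ → ℕ → State → Set
  Rows total m σ = regs σ ri ≡ + m × Constants σ ×
    Σ[ m≤n ∈ m ≤ n ] ∃[ R ] ∃[ base ]
      regs σ rR ≡ R × regs σ rbase ≡ + base × output σ ++ entries base (rows m m≤n R) ≡ total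

  rowTime : ℕ
  rowTime = 24 + (k * (2 + layerTime) + 2)

  run-writeRow : ∀ {total m σ} → Rows total (suc m) σ → Runs writeRow σ rowTime (Rows total m)
  run-writeRow {total} {m} {σ} (i≡ , constants@(k≡ , B≡ , M≡ , K≡ , _) , m<n , R , base , R≡ , base≡ , out) =
    run-seq $ run-reg $ run-seq $ run-setCarry R R≡ B≡ K≡ $
    run-seq $ run-reg $ run-seq $ run-reg $
    (for rcols (Columns i (nextRest R) (carryOf R) t total) proj₁
      (run-writeLayer {t = t} (subst (λ a → Window a t) (sym i≡m) (window-rows m _ (nextRest R)))) k
      (k≡ , (constants , trans (decr-≡ i≡) (cong +_ (sym i≡m)) , refl , refl)
      , id , 0 , base , refl , (λ a → refl) , base≡ , out)
    and λ { (_ , (constants′ , i≡′ , R≡′ , _) , _ , _ , base′ , _ , _ , base≡′ , out′) →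
      trans i≡′ (cong +_ i≡m) , constants′ , _ , nextRest R , base′ , R≡′ , base≡′ , out′ })
    where
    i = fromℕ< m<n
    t = rows m (ℕ.<⇒≤ m<n) (nextRest R)
    i≡m : toℕ i ≡ m
    i≡m = Fin.toℕ-fromℕ< m<n

-- Correctness of the preparation and of the whole program

module Machine {k′ n′ : ℕ} (W : ℕ) (w : Vector ℤ (suc k′)) (threshold : ℤ) where
  n K : ℕ
  n = suc n′
  K = 2 ^ n′

  open Threshold {k′} {n} W w K
  open Correct {k′} {n} W w K

  Given : State → Set
  Given σ = regs σ rn ≡ + n × regs σ rp ≡ 0ℤ × output σ ≡ []

  Reading : ℕ → State → Set
  Reading c σ = regs σ rcount ≡ + c × regs σ rk ≡ + k × regs σ rW ≡ + W × regs σ rR ≡ threshold × Given σ ×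
    ∃[ j ] Σ[ u ∈ Vector ℤ c ] ∃[ b ]
      regs σ rj ≡ + j × input σ ≡ tabulate u × regs σ rB ≡ + b
      × j + c ≡ k × b + c * (W + W) ≡ B
      × (∀ a j′ → toℕ j′ ≡ j + toℕ a → w j′ ≡ u a)
      × (∀ j′ → toℕ j′ < j → memory σ (+ toℕ j′) ≡ w j′)

  run-readWeight : ∀ {c σ} → Reading (suc c) σ → Runs readWeight σ 18 (Reading c)
  run-readWeight {c} {σ} (c≡ , k≡ , W≡ , R≡ , given , j , u , b , j≡ , in≡ , b≡ , j+c , b+c , unread , stored) =
    within 18 $ run-seq $ run-reg $ run-seq $ run-read in≡ $ run-seq $ run-mem $ run-seq $ run-reg $ run-reg
      ( decr-≡ c≡ , k≡ , W≡ , R≡ , given , suc j , u ∘ suc , b + (W + W)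
      , suc-≡ j≡ , refl , cong₂ ℤ._+_ b≡ (cong₂ ℤ._+_ W≡ W≡)
      , trans (sym (ℕ.+-suc j c)) j+c , trans (ℕ.+-assoc b (W + W) (c * (W + W))) b+c
      , (λ a j′ j′≡ → unread (suc a) j′ (trans j′≡ (sym (ℕ.+-suc j (toℕ a)))))
      , stored′)
    where
    stored′ : ∀ j′ → toℕ j′ < suc j →
              update ℤ._≟_ (memory σ) (regs σ rj) (u zero) (+ toℕ j′) ≡ w j′
    -- The integer comparison inside `update` computes to `≡ᵇ` on the indices, so that is the test
    -- to abstract.
    stored′ j′ j′≤j rewrite j≡ with toℕ j′ ℕ.≡ᵇ j in eq
    ... | true  = sym (unread zero j′
      (trans (ℕ.≡ᵇ⇒≡ (toℕ j′) j (subst T (sym eq) tt)) (sym (ℕ.+-identityʳ j))))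
    ... | false = stored j′ (ℕ.≤∧≢⇒< (ℕ.s≤s⁻¹ j′≤j) (λ j′≡j → subst T eq (ℕ.≡⇒≡ᵇ (toℕ j′) j j′≡j)))

  Doubling : ℕ → State → Set
  Doubling c σ = regs σ rcount ≡ + c × regs σ rk ≡ + k × regs σ rB ≡ + B × regs σ rM ≡ + M
    × (∀ j → memory σ (+ toℕ j) ≡ w j) × regs σ rR ≡ threshold × Given σ ×
    ∃[ v ] regs σ rK ≡ + v × v * 2 ^ c ≡ K

  run-double : ∀ {c σ} → Doubling (suc c) σ → Runs double σ 8 (Doubling c)
  run-double {c} (c≡ , k≡ , B≡ , M≡ , weights , R≡ , given , v , v≡ , eq) =
    run-seq $ run-reg $ run-reg
      ( decr-≡ c≡ , k≡ , B≡ , M≡ , weights , R≡ , given , v + v , cong₂ ℤ._+_ v≡ v≡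
      , trans (cong (_* 2 ^ c) (cong (v ℕ.+_) (sym (ℕ.+-identityʳ v))))
        (trans (cong (_* 2 ^ c) (ℕ.*-comm 2 v)) (trans (ℕ.*-assoc v 2 (2 ^ c)) eq)))

  Subtracting : ℕ → State → Set
  Subtracting c σ = regs σ rcount ≡ + c × Constants σ × Given σ ×
    ∃[ R ] regs σ rR ≡ R × R ℤ.- + c ℤ.* + K ≡ proj₂ (origin threshold)

  run-subtract : ∀ {c σ} → Subtracting (suc c) σ → Runs subtract σ 8 (Subtracting c)
  run-subtract {c} {σ} (c≡ , constants@(_ , _ , _ , K≡ , _) , given , R , R≡ , eq) =
    run-seq $ run-reg $ run-reg
      ( decr-≡ c≡ , constants , given , R ℤ.- + K , cong₂ ℤ._-_ R≡ K≡
      , trans (ring R (+ c) (+ K)) eq)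
    where ring : ∀ R c K → R ℤ.- K ℤ.- c ℤ.* K ≡ R ℤ.- (1ℤ ℤ.+ c) ℤ.* K
          ring = solve-∀

  -- This also looks forward: the rounds still due lead from the current registers to the fixed
  -- result of the search.
  Searching : ℕ → State → Set
  Searching c σ = regs σ rcount ≡ + c × Constants σ × regs σ rn ≡ + n × output σ ≡ []
    × seek c (regs σ rp , regs σ rR) ≡ seek (suc M) (origin threshold)

  run-search : ∀ {c σ} → Searching (suc c) σ → Runs search σ 16 (Searching c)
  run-search {c} {σ} (c≡ , constants@(_ , _ , _ , K≡ , _) , n≡ , out , eq) =
    run-seq $ run-reg $ branch (0ℤ ℤ.- regs σ rR ℤ.≤? 0ℤ)
    where
    σ′ = setReg rcount (regs σ rcount ℤ.- 1ℤ) σ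
    choice : Bool → ℤ × ℤ
    choice b = if b then (regs σ rp , regs σ rR) else (regs σ rp ℤ.+ 1ℤ , regs σ rR ℤ.+ + K)
    branch : Dec (0ℤ ℤ.- regs σ rR ℤ.≤ 0ℤ) →
             Runs (if lit 0ℤ ⊟ reg rR >0then (rp := reg rp ⊞ lit 1ℤ ⨟ rR := reg rR ⊞ reg rK) else skip)
                  σ′ 12 (Searching c)
    branch (yes le) = run-if
      (λ gt → ⊥-elim (ℤ.<⇒≱ gt le))
      (λ _ → within 8 $ run-skip (decr-≡ c≡ , constants , n≡ , out ,
        trans (cong (seek c ∘ choice) (sym (does-≤ le))) eq))
    branch (no nle) = run-if
      (λ gt → run-seq $ run-reg $ run-reg (decr-≡ c≡ , constants , n≡ , out ,
        trans (cong (λ K → seek c (regs σ rp ℤ.+ 1ℤ , regs σ rR ℤ.+ K)) K≡)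
        (trans (cong (seek c ∘ choice) (sym (does-> gt))) eq)))
      (λ le → ⊥-elim (nle le))

  Prepared : ℤ → ℤ → State → Set
  Prepared p R σ = Constants σ × regs σ rn ≡ + n × output σ ≡ [] × regs σ rp ≡ p × regs σ rR ≡ R

  prepareTime : ℕ
  prepareTime = 6 + ((k * 20 + 2) + (6 + (4 + ((n′ * 10 + 2) + (4 + (2 + ((B * 10 + 2) + (4 + (suc M * 18 + 2)))))))))

  run-prepare : Runs prepare (initial (encodeInstance k n W threshold w)) prepareTime (Searching 0)
  run-prepare =
    run-seq $ run-read refl $ run-seq $ run-read refl $ run-seq $ run-read refl $ run-seq $ run-read refl $
    run-seq $ run-reg $
    for rcount Reading proj₁ run-readWeight k
      ( refl , refl , refl , refl , (refl , refl , refl) , 0 , w , 0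
      , refl , refl , refl , refl , ℕ.*-distribˡ-+ k W W
      , (λ a j j≡a → cong w (Fin.toℕ-injective j≡a)) , (λ _ ()))
    then λ { (_ , k≡ , _ , R≡ , given@(n≡ , _) , j , _ , b , _ , _ , b≡ , j≡ , b≡B , _ , stored) →
    let B≡ = trans b≡ (cong +_ (trans (sym (ℕ.+-identityʳ b)) b≡B)) in
    run-seq $ run-reg $ run-seq $ run-reg $ run-seq $ run-reg $
    for rcount Doubling proj₁ run-double n′
      ( decr-≡ n≡ , k≡ , B≡ , cong₂ ℤ._+_ B≡ B≡
      , (λ j′ → stored j′ (subst (toℕ j′ <_) (sym (trans (sym (ℕ.+-identityʳ j)) j≡)) (Fin.toℕ<n j′)))
      , R≡ , given , 1 , refl , ℕ.+-identityʳ K)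
    then λ { (_ , k≡ , B≡ , M≡ , weights , R≡ , given , v , v≡ , v≡K) →
    run-seq $ run-reg $ run-seq $ run-reg $
    for rcount Subtracting proj₁ run-subtract B
      ( B≡ , (k≡ , B≡ , M≡ , trans v≡ (cong +_ (trans (sym (ℕ.*-identityʳ v)) v≡K)) , weights) , given
      , 0ℤ ℤ.- threshold , cong (λ u → 0ℤ ℤ.- u) R≡ , refl)
    then λ { (_ , constants@(_ , _ , M≡ , _) , (n≡ , p≡ , out) , R , R≡ , R≡′) →
    run-seq $ run-reg $
    for rcount Searching proj₁ run-search (suc M)
      ( suc-≡ M≡ , constants , n≡ , out
      , cong (seek (suc M)) (cong₂ _,_ p≡ (trans R≡ (trans (sym (ℤ.+-identityʳ R)) R≡′)))) } } }

  constructTime : ℕ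
  constructTime = 8 + (12 + (2 + (n * (2 + rowTime) + 2)))

  module _ (p R : ℤ) where

    private
      layers : Layers
      layers = rows n ℕ.≤-refl R

      total : List ℤ
      total = target layers 1ℤ p ∷ entries 1 layers

    run-construct : ∀ {σ} → Prepared p R σ → Runs construct σ constructTime (λ τ → output τ ≡ total)
    run-construct {σ} (constants@(_ , _ , M≡ , _) , n≡ , out , p≡ , R≡) =
      run-seq $ run-reg $ run-seq $ run-reg $ run-seq $ run-reg $ run-seq $ run-reg $
      run-seq $ run-writeTarget layers 1ℤ p refl M≡ refl p≡ $
      run-seq $ run-reg $ loop and λ { (_ , _ , _ , _ , _ , _ , _ , out′) →
        trans (sym (List.++-identityʳ _)) out′ }
      where
      σ₁ : State
      σ₁ = setReg ri (regs σ rn) (emit (target layers 1ℤ p)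
        (setReg rq (regs σ rp) (setReg rbase 1ℤ (setReg rhi (regs σ rM) (setReg rlo 0ℤ σ)))))
      start : Rows total n σ₁
      start = n≡ , constants , ℕ.≤-refl , R , 1 , R≡ , refl ,
              cong (λ o → (o ++ [ target layers 1ℤ p ]) ++ entries 1 layers) out
      loop : Runs (while reg ri >0do writeRow) σ₁ (n * (2 + rowTime) + 2) (Rows total 0)
      loop = for ri (Rows total) proj₁ run-writeRow n start

    run-program : seek (suc M) (origin threshold) ≡ (p , R) →
      Runs (prepare ⨟ construct) (initial (encodeInstance k n W threshold w))
           (prepareTime + constructTime) (λ τ → output τ ≡ total)
    run-program found = run-prepare then λ { (_ , constants , n≡ , out , eq) →
      run-construct (constants , n≡ , out , cong proj₁ (trans eq found) , cong proj₂ (trans eq found)) }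

-- Arithmetic of the time bound

absorb : ∀ {x y} a b → x ≤ y → 1 ≤ y → x * a + b ≤ y * (a + b)
absorb {x} {y} a b x≤y 1≤y = begin
  x * a + b     ≤⟨ ℕ.+-mono-≤ (ℕ.*-monoˡ-≤ a x≤y) (ℕ.m≤n*m b y {{ℕ.>-nonZero 1≤y}}) ⟩
  y * a + y * b ≡⟨ ℕ.*-distribˡ-+ y a b ⟨
  y * (a + b)   ∎
  where open ℕ.≤-Reasoning

prepare-bound : ∀ {k n B M N} → k ≤ N → n ≤ N → B ≤ N → M ≤ N → 1 ≤ N →
  6 + ((k * 20 + 2) + (6 + (4 + ((n * 10 + 2) + (4 + (2 + ((B * 10 + 2) + (4 + (suc M * 18 + 2)))))))))
  ≤ N * 110
prepare-bound {k} {n} {B} {M} {N} k≤N n≤N B≤N M≤N 1≤N = begin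
  _ ≡⟨ collect k n B M ⟩
  k * 20 + n * 10 + B * 10 + (M * 18 + 52)
    ≤⟨ ℕ.+-mono-≤ (ℕ.+-mono-≤ (ℕ.+-mono-≤ (ℕ.*-monoˡ-≤ 20 k≤N) (ℕ.*-monoˡ-≤ 10 n≤N)) (ℕ.*-monoˡ-≤ 10 B≤N))
                  (absorb 18 52 M≤N 1≤N) ⟩
  N * 20 + N * 10 + N * 10 + N * 70 ≡⟨ combine N ⟩
  N * 110 ∎
  where
  open ℕ.≤-Reasoning
  collect : ∀ k n B M →
    6 + ((k * 20 + 2) + (6 + (4 + ((n * 10 + 2) + (4 + (2 + ((B * 10 + 2) + (4 + ((1 + M) * 18 + 2)))))))))
    ≡ k * 20 + n * 10 + B * 10 + (M * 18 + 52)
  collect = ℕ-ring.solve-∀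
  combine : ∀ N → N * 20 + N * 10 + N * 10 + N * 70 ≡ N * 110
  combine = ℕ-ring.solve-∀

construct-bound : ∀ {k n M} → 1 ≤ k → 1 ≤ n → 1 ≤ M →
  8 + (12 + (2 + (n * (2 + (24 + (k * (2 + (23 + (M * 70 + 2 + 4))) + 2))) + 2))) ≤ n * (k * M) * 153
construct-bound {k} {n} {M} 1≤k 1≤n 1≤M = begin
  _ ≡⟨ collect k n M ⟩
  n * (k * (M * 70 + 31) + 28) + 24
    ≤⟨ ℕ.+-monoˡ-≤ 24 (ℕ.*-monoʳ-≤ n (ℕ.+-monoˡ-≤ 28 (ℕ.*-monoʳ-≤ k (absorb 70 31 (ℕ.≤-refl {M}) 1≤M)))) ⟩
  n * (k * (M * 101) + 28) + 24
    ≡⟨ cong (λ a → n * (a + 28) + 24) (ℕ.*-assoc k M 101) ⟨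
  n * (k * M * 101 + 28) + 24
    ≤⟨ ℕ.+-monoˡ-≤ 24 (ℕ.*-monoʳ-≤ n (absorb 101 28 (ℕ.≤-refl {k * M}) 1≤kM)) ⟩
  n * (k * M * 129) + 24
    ≡⟨ cong (_+ 24) (ℕ.*-assoc n (k * M) 129) ⟨
  n * (k * M) * 129 + 24
    ≤⟨ absorb 129 24 (ℕ.≤-refl {n * (k * M)}) (ℕ.*-mono-≤ 1≤n 1≤kM) ⟩
  n * (k * M) * 153 ∎
  where
  open ℕ.≤-Reasoning
  1≤kM : 1 ≤ k * M
  1≤kM = ℕ.*-mono-≤ 1≤k 1≤M
  collect : ∀ k n M →
    8 + (12 + (2 + (n * (2 + (24 + (k * (2 + (23 + (M * 70 + 2 + 4))) + 2))) + 2)))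
    ≡ n * (k * (M * 70 + 31) + 28) + 24
  collect = ℕ-ring.solve-∀

-- Everything is charged to the n k M = 4Z inner nodes: 110 + 153 = 263 units each, hence 4 · 263 =
-- 1052. `n₀` is n - 1, the number of doublings that build `K`.
total-bound : ∀ {k n n₀ B M Z} → 1 ≤ k → n₀ ≤ n → 1 ≤ n → B ≤ M → 1 ≤ M → n * (k * M) ≡ 4 * Z →
  6 + ((k * 20 + 2) + (6 + (4 + ((n₀ * 10 + 2) + (4 + (2 + ((B * 10 + 2) + (4 + (suc M * 18 + 2)))))))))
  + (8 + (12 + (2 + (n * (2 + (24 + (k * (2 + (23 + (M * 70 + 2 + 4))) + 2))) + 2)))) ≤ 1052 * Z
total-bound {k} {n} {n₀} {B} {M} {Z} 1≤k n₀≤n 1≤n B≤M 1≤M nodes = begin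
  _ ≤⟨ ℕ.+-mono-≤ (prepare-bound {k} {n₀} {B} {M} (ℕ.≤-trans (≤* 1≤M) kM≤N) (ℕ.≤-trans n₀≤n (≤* 1≤kM))
                     (ℕ.≤-trans B≤M M≤N) M≤N (ℕ.*-mono-≤ 1≤n 1≤kM))
                  (construct-bound {k} {n} {M} 1≤k 1≤n 1≤M) ⟩
  n * (k * M) * 110 + n * (k * M) * 153 ≡⟨ cong (λ N → N * 110 + N * 153) nodes ⟩
  4 * Z * 110 + 4 * Z * 153             ≡⟨ combine Z ⟩
  1052 * Z ∎
  where
  open ℕ.≤-Reasoning
  1≤kM : 1 ≤ k * M
  1≤kM = ℕ.*-mono-≤ 1≤k 1≤M
  ≤* : ∀ {a b} → 1 ≤ b → a ≤ a * b
  ≤* {a} {b} 1≤b = ℕ.m≤m*n a b {{ℕ.>-nonZero 1≤b}}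
  kM≤N : k * M ≤ n * (k * M)
  kM≤N = ℕ.m≤n*m (k * M) n {{ℕ.>-nonZero 1≤n}}
  M≤N : M ≤ n * (k * M)
  M≤N = ℕ.≤-trans (ℕ.m≤n*m M k {{ℕ.>-nonZero 1≤k}}) kM≤N
  combine : ∀ Z → 4 * Z * 110 + 4 * Z * 153 ≡ 1052 * Z
  combine = ℕ-ring.solve-∀

-- Assembly

-- The 6 comes from the size: 4k²Wn inner nodes, and two sinks absorbed by 2 ≤ 2k²Wn.
Construction : (k n W : ℕ) → (Input k n → Bool) → ℤ → Vector ℤ k → Set
Construction k n W f T w =
  Σ[ D ∈ OBDD (interleavedOrder k n) ]
    Represents D f × width D ≤ 6 * (k * W) × size D ≤ 6 * (k ^ 2 * W * n) ×
    (∃[ t ] t ≤ 1052 * (k ^ 2 * W * n) ×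
      (prepare ⨟ construct) on encodeInstance k n W T w Outputs encodeOBDD D InTime t)

outputs : ∀ {P is t t′ os os′} → Runs P (initial is) t (λ τ → State.output τ ≡ os) → t ≤ t′ → os ≡ os′ →
          ∃[ s ] s ≤ t′ × P on is Outputs os′ InTime s
outputs (τ , s , ⇓P , s≤t , out) t≤t′ eq = s , ℕ.≤-trans s≤t t≤t′ , τ , ⇓P , trans out eq

construction : (k n W : ℕ) → k ≥ 1 → n ≥ 1 → W ≥ 1 →
  (f : Input k n → Bool) (T : ℤ) (w : Vector ℤ k) →
  WeightsBoundedBy W w → IsThresholdOf T w f → Construction k n W f T w
construction (suc k′) (suc n′) W _ _ 1≤W f T w bounded thr =
  -- Passing the result of the search with its equation turns `p` and `R` into variables.
  build (seek (suc M) (origin T)) refl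
  where
  open Threshold {k′} {suc n′} W w (2 ^ n′)
  open Bounded bounded
  open Machine {k′} {n′} W w T using (n; run-program; prepareTime; constructTime)

  Z : ℕ
  Z = k ^ 2 * W * n

  1≤Z : 1 ≤ Z
  1≤Z = ℕ.*-mono-≤ (ℕ.*-mono-≤ (ℕ.m^n>0 k 2) 1≤W) (s≤s z≤n)

  1≤M : 1 ≤ M
  1≤M = ℕ.≤-trans (ℕ.*-mono-≤ (s≤s (z≤n {k′})) 1≤W)
          (ℕ.≤-trans (ℕ.m≤m+n H H) (ℕ.m≤m+n B B))

  nodes : n * (k * M) ≡ 4 * Z
  nodes = ring n k W
    where ring : ∀ n k W → n * (k * (k * W + k * W + (k * W + k * W))) ≡ 4 * (k * (k * 1) * W * n)
          ring = ℕ-ring.solve-∀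

  build : ∀ s → seek (suc M) (origin T) ≡ s → Construction k n W f T w
  build (p , R) found = D , represents , width-≤ , size-≤ , result
    where
    layers : Layers
    layers = rows n ℕ.≤-refl R

    increasing : Increasing layers
    increasing = rows-increasing n ℕ.≤-refl R

    D : OBDD (interleavedOrder k n)
    D = obdd layers increasing p

    value : (p ℤ.- + B) ℤ.* + (2 ^ n′) ℤ.- R ≡ T
    value = trans (cong (λ (p , R) → (p ℤ.- + B) ℤ.* + (2 ^ n′) ℤ.- R) (sym found))
              (trans (seek-value (suc M) (origin T)) (origin-value T))

    start : Start p R
    start = subst (λ (p , R) → Start p R) found (seek-start (suc M) (origin T) (origin-seeking T))

    represents : Represents D f
    represents x = subst (_⟨_⟩⇝_ D (enter layers p) x)
      (accepts-threshold {f = f} thr (cong (2 ^ n′ ℕ.+_) (sym (ℕ.+-identityʳ (2 ^ n′)))) {p} {R} value start x)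
      (enter-path layers increasing p x p (proj₂ (proj₂ (rows-tame n ℕ.≤-refl R))))

    width-≤ : width D ≤ 6 * (k * W)
    width-≤ = ℕ.≤-trans (width-obdd layers increasing p)
      (ℕ.≤-trans (ℕ.≤-reflexive (ring (k * W))) (ℕ.*-monoˡ-≤ (k * W) (ℕ.m≤m+n 4 2)))
      where ring : ∀ H → H + H + (H + H) ≡ 4 * H
            ring = ℕ-ring.solve-∀

    size-≤ : size D ≤ 6 * Z
    size-≤ = begin
      length layers * M + 2 ≡⟨ cong (λ l → l * M + 2) (length-rows n ℕ.≤-refl R) ⟩
      n * k * M + 2         ≡⟨ cong (_+ 2) (trans (ℕ.*-assoc n k M) nodes) ⟩
      4 * Z + 2             ≤⟨ ℕ.+-monoʳ-≤ (4 * Z) (ℕ.*-monoʳ-≤ 2 1≤Z) ⟩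
      4 * Z + 2 * Z         ≡⟨ ℕ.*-distribʳ-+ Z 4 2 ⟨
      6 * Z                 ∎
      where open ℕ.≤-Reasoning

    time-≤ : prepareTime + constructTime ≤ 1052 * Z
    time-≤ = total-bound {k} {n} {n′} {B} {M} {Z} (s≤s z≤n) (ℕ.n≤1+n n′) (s≤s z≤n) (ℕ.m≤m+n B B) 1≤M nodes

    result : ∃[ t ] t ≤ 1052 * Z ×
      (prepare ⨟ construct) on encodeInstance k n W T w Outputs encodeOBDD D InTime t
    result = outputs (run-program p R found) time-≤ (sym (encode-obdd layers increasing p))

mainTheorem4 : ∃[ c ] c > 0 ×
    ((k n W : ℕ) → k ≥ 1 → n ≥ 1 → W ≥ 1 →
    (f : Input k n → Bool) → 𝕋 W k n f →
    Σ[ D ∈ OBDD (interleavedOrder k n) ]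
    Represents D f × width D ≤ c * (k * W) × size D ≤ c * (k ^ 2 * W * n)) ×
    (Σ[ P ∈ Program ] Σ[ d ∈ ℕ ]
    ((k n W : ℕ) → k ≥ 1 → n ≥ 1 → W ≥ 1 →
    (f : Input k n → Bool) (T : ℤ) (w : Vector ℤ k) →
    WeightsBoundedBy W w → IsThresholdOf T w f →
    Σ[ D ∈ OBDD (interleavedOrder k n) ]
    Represents D f × width D ≤ c * (k * W) × size D ≤ c * (k ^ 2 * W * n) ×
    (∃[ t ] t ≤ d * (k ^ 2 * W * n) ×
    P on encodeInstance k n W T w Outputs encodeOBDD D InTime t)))
mainTheorem4 = 6 , s≤s z≤n
  , (λ k n W 1≤k 1≤n 1≤W f (T , w , bounded , thr) →
      let D , represents , width≤ , size≤ , _ = construction k n W 1≤k 1≤n 1≤W f T w bounded thr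
      in D , represents , width≤ , size≤)
  , (prepare ⨟ construct) , 1052 , construction
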